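{- Let $m\ge2$, let $h$ be a positive integer and let $\lambda=(\lambda_1,\ldots,\lambda_{m-1},0)$ be a partition with $\lambda_m=0$. Let $\lambda^{(0)},\ldots,\lambda^{(N)}$ be the sequence of dominating partitions for $G_{h,\lambda}(\mathbf{x})$, write $\lambda^{(N)}=(\lambda_1+a_1,\ldots,\lambda_m+a_m)$ and $b_k=a_1+\cdots+a_k$. Let $k\in\{1,\ldots,m\}$, let $I$ be a proper nonempty subset of $[m]$, and let $F=F(I)$ be a facet of $\mathrm{Newt}(s_{\lambda^{(b_k)}}(\mathbf{x}))$ defined by the inequality $\sum_{i\in I}x_i\le\sum_{i=1}^{|I|}\lambda^{(b_k)}_i=:L$. Let $H(F)$ be one of the two hyperplanes $H(F)_1=\{\mathbf{x}\in\mathbb{R}^m:\sum_{i\in I}x_i=L\}$, $H(F)_0=\{\mathbf{x}\in\mathbb{R}^m:\sum_{i\notin I}x_i=|\lambda^{(b_k)}|-L\}$, and suppose $H(F)$ isolates $\mathrm{Newt}(G_{h,\lambda}(\mathbf{x}))$ and is not of the form $\mathcal{J}_j=\{\mathbf{x}\in\mathbb{R}^m:\sum_{i\ne j}x_i=|\lambda|-\lambda_1\}$ for any $j\in[m]$. Then $H(F)$ is a facet-defining hyperplane of $\mathrm{Newt}(G_{h,\lambda}(\mathbf{x}))$.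
   Context: $\mathbf{x}=(x_1,\ldots,x_m)$, $[m]=\{1,\ldots,m\}$. $\mathrm{Newt}(f)$ is the convex hull of exponent vectors of monomials with nonzero coefficient in $f$. Schur polynomial $s_\mu(x_1,\ldots,x_m)=\sum_T\mathbf{x}^T$ over semistandard Young tableaux of shape $\mu$ with entries in $[m]$; $\mathrm{Newt}(s_\mu)$ is the convex hull of the $S_m$-orbit of $\mu$, an $(m-1)$-dimensional polytope in the hyperplane $\sum x_i=|\mu|$ (when $\mu$ is not constant), whose facets are cut out by inequalities $\sum_{i\in I}x_i\le\sum_{i=1}^{|I|}\mu_i$. For a partition $\mu\supseteq\lambda$ with at most $m$ rows, $b_{h,\lambda\mu}$ is the number of fillings of $\mu/\lambda$ with positive integers strictly increasing along rows and columns, entries in row $r$ from $\{1,\ldots,h(r-1)\}$; $A(h,\lambda)=\{\mu\mid b_{h,\lambda\mu}\ne0\}$; $G_{h,\lambda}(\mathbf{x})=\sum_{\mu\in A(h,\lambda)}(-1)^{|\mu/\lambda|}b_{h,\lambda\mu}s_\mu(\mathbf{x})$. Sequence of dominating partitions: $\lambda^{(0)}=\lambda$; for $k\ge1$, $\lambda^{(k)}$ is obtained from $\lambda^{(k-1)}$ by adding a box in row $r_k$, the smallest $r_k\in[m]$ with $\lambda^{(k-1)}_{r_k}-\lambda_{r_k}<h(r_k-1)$ such that adding a box in that row gives a partition; it runs up to $\lambda^{(N)}$ where $\deg G_{h,\lambda}=|\lambda|+N$. A hyperplane $H=\{f(\mathbf{x})=a\}$ ($f$ linear) isolates a set $S$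 if $S\subseteq\{f\ge a\}$ or $S\subseteq\{f\le a\}$. A hyperplane $H$ is facet-defining for the ($m$-dimensional) polytope $\mathcal{P}$ if it isolates $\mathcal{P}$ and $\dim(\mathcal{P}\cap H)=m-1$. -}

module Defs where

open import Data.Bool using (Bool; true; false; _∧_; if_then_else_; not)
open import Data.Nat using (ℕ; zero; suc; _+_; _*_; _∸_; _≤_; _<ᵇ_; _≤ᵇ_; _≡ᵇ_)
open import Data.Integer as ℤ using (ℤ) renaming (+_ to pos)
open import Data.Fin using (Fin; zero; suc; toℕ; inject₁)
import Data.Fin as Fin
open import Data.List as List using (List; []; _∷_; concatMap; length; filterᵇ; take; drop; allFin)
open import Data.Vec as Vec using (Vec; []; _∷_; lookup; toList; tabulate; updateAt; zipWith)
open import Data.Sum using (_⊎_)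
open import Data.Maybe using (Maybe; just; nothing)
open import Data.Product using (Σ; _×_; ∃)
open import Data.Fin.Subset using (Subset; ∁; ⁅_⁆)
open import Relation.Binary.PropositionalEquality using (_≡_)
open import Relation.Nullary using (¬_)

range : ℕ → ℕ → List ℕ
range lo hi = List.map (lo +_) (List.upTo (suc hi ∸ lo))

weakInc : ℕ → ℕ → ℕ → List (List ℕ)
weakInc lo hi zero    = [] ∷ []
weakInc lo hi (suc n) = concatMap (λ v → List.map (v ∷_) (weakInc v hi n)) (range lo hi)

strictInc : ℕ → ℕ → ℕ → List (List ℕ)
strictInc lo hi zero    = [] ∷ []
strictInc lo hi (suc n) = concatMap (λ v → List.map (v ∷_) (strictInc (suc v) hi n)) (range lo hi)

choices : {A : Set} → List (List A) → List (List A)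
choices []         = [] ∷ []
choices (xs ∷ xss) = concatMap (λ x → List.map (x ∷_) (choices xss)) xs

headℕ : List ℕ → ℕ
headℕ []      = 0
headℕ (x ∷ _) = x

count : {A : Set} → (A → Bool) → List A → ℕ
count p xs = length (filterᵇ p xs)

boxVecs : ∀ {m} → Vec ℕ m → Vec ℕ m → List (Vec ℕ m)
boxVecs []         []         = [] ∷ []
boxVecs (l ∷ ls) (u ∷ us) = concatMap (λ v → List.map (v ∷_) (boxVecs ls us)) (range l u)

∣_∣ᵥ : ∀ {m} → Vec ℕ m → ℕ
∣ v ∣ᵥ = Vec.sum v

-- Partitions (with at most m rows, stored as Vec ℕ m, row i+1 at index i)

IsPartition : ∀ {m} → Vec ℕ m → Set
IsPartition {m} ν = (i j : Fin m) → i Fin.≤ j → lookup ν j ≤ lookup ν i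

decreasingᵇ : List ℕ → Bool
decreasingᵇ (x ∷ y ∷ xs) = (y ≤ᵇ x) ∧ decreasingᵇ (y ∷ xs)
decreasingᵇ _            = true

-- Column strictness for (skew) tableaux given row by row.
-- A row is given as the list of its entries together with its offset
-- (number of cells of the inner shape in that row).

strictAbove : List ℕ → List ℕ → Bool
strictAbove (t ∷ ts) (b ∷ bs) = (t <ᵇ b) ∧ strictAbove ts bs
strictAbove _        _        = true

-- consecutive rows: top row with offset ot, bottom row with offset ob (ob ≤ ot)
columnsOK : List ℕ → List (List ℕ) → Bool
columnsOK (ot ∷ ob ∷ os) (t ∷ b ∷ rs) = strictAbove t (drop (ot ∸ ob) b) ∧ columnsOK (ob ∷ os) (b ∷ rs)
columnsOK _ _ = true

-- b_{h,λμ}: fillings of μ/λ, strictly increasing along rows and columns,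
-- entries in row r (1-based) from {1, …, h(r-1)}; row index i = r-1 (0-based).
-- (Used for partitions μ ⊇ λ.)

bcoef : ∀ {m} → ℕ → Vec ℕ m → Vec ℕ m → ℕ
bcoef {m} h lam mu =
  count (columnsOK (toList lam))
        (choices (toList (tabulate {n = m} (λ i → strictInc 1 (h * toℕ i) (lookup mu i ∸ lookup lam i)))))

-- Kostka number: number of SSYT of shape μ, entries in [m], content α
-- = coefficient of x^α in s_μ(x_1,…,x_m).

contentIs : ∀ {m} → Vec ℕ m → List (List ℕ) → Bool
contentIs {m} α rows =
  List.foldr _∧_ true (List.map (λ j → count (λ e → e ≡ᵇ suc (toℕ j)) (List.concat rows) ≡ᵇ lookup α j) (allFin m))

kostka : ∀ {m} → Vec ℕ m → Vec ℕ m → ℕ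
kostka {m} mu α =
  count (λ rows → columnsOK (toList (Vec.replicate m 0)) rows ∧ contentIs α rows)
        (choices (toList (Vec.map (weakInc 1 m) mu)))

SuppSchur : ∀ {m} → Vec ℕ m → Vec ℕ m → Set
SuppSchur mu α = ¬ (kostka mu α ≡ 0)

-- G_{h,λ}(x) = Σ_{μ ∈ A(h,λ)} (-1)^{|μ/λ|} b_{h,λμ} s_μ(x).
-- Every μ with b_{h,λμ} ≠ 0 satisfies λ_i ≤ μ_i ≤ λ_i + h(i-1) (a strictly
-- increasing row with entries in {1..h(i-1)} has at most h(i-1) cells),
-- so the sum ranges over the partitions in that box; the others have b = 0.

sign : ℕ → ℤ
sign zero          = pos 1
sign (suc zero)    = ℤ.- (pos 1)
sign (suc (suc n)) = sign n

candidates : ∀ {m} → ℕ → Vec ℕ m → List (Vec ℕ m)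
candidates {m} h lam =
  filterᵇ (λ mu → decreasingᵇ (toList mu))
          (boxVecs lam (tabulate (λ i → lookup lam i + h * toℕ i)))

coeffG : ∀ {m} → ℕ → Vec ℕ m → Vec ℕ m → ℤ
coeffG h lam α =
  List.foldr ℤ._+_ (pos 0)
    (List.map (λ mu → sign (∣ mu ∣ᵥ ∸ ∣ lam ∣ᵥ) ℤ.* (pos (bcoef h lam mu)) ℤ.* (pos (kostka mu α)))
              (candidates h lam))

SuppG : ∀ {m} → ℕ → Vec ℕ m → Vec ℕ m → Set
SuppG h lam α = ¬ (coeffG h lam α ≡ pos 0)

DegG : ∀ {m} → ℕ → Vec ℕ m → ℕ → Set
DegG {m} h lam d =
  (Σ (Vec ℕ m) λ α → SuppG h lam α × ∣ α ∣ᵥ ≡ d) × ((α : Vec ℕ m) → SuppG h lam α → ∣ α ∣ᵥ ≤ d)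

addOK : ∀ {m} → Vec ℕ m → Fin m → Bool
addOK ν zero    = true
addOK ν (suc i) = lookup ν (suc i) <ᵇ lookup ν (inject₁ i)

-- row i is admissible: ν_i - λ_i < h(i) (0-based, i.e. h(r-1) for r = i+1)
-- and adding a box there gives a partition
admissible : ∀ {m} → ℕ → Vec ℕ m → Vec ℕ m → Fin m → Bool
admissible h lam ν i = ((lookup ν i ∸ lookup lam i) <ᵇ h * toℕ i) ∧ addOK ν i

firstTrue : ∀ {m} → (Fin m → Bool) → List (Fin m) → Maybe (Fin m)
firstTrue p []       = nothing
firstTrue p (i ∷ is) = if p i then just i else firstTrue p is

domStep : ∀ {m} → ℕ → Vec ℕ m → Vec ℕ m → Vec ℕ m
domStep {m} h lam ν with firstTrue (admissible h lam ν) (allFin m)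
... | just r  = updateAt ν r suc
... | nothing = ν

domSeq : ∀ {m} → ℕ → Vec ℕ m → ℕ → Vec ℕ m
domSeq h lam zero    = lam
domSeq h lam (suc k) = domStep h lam (domSeq h lam k)

sumOver : ∀ {m} → Subset m → Vec ℕ m → ℕ
sumOver S x = Vec.sum (zipWith (λ s xi → if s then xi else 0) S x)

record Hyp (m : ℕ) : Set where
  constructor hyp
  field
    coords : Subset m
    value  : ℕ

OnHyp : ∀ {m} → Hyp m → Vec ℕ m → Set
OnHyp (hyp S a) x = sumOver S x ≡ a

-- H isolates the (convex hull of the) point set P
Isolates : ∀ {m} → Hyp m → (Vec ℕ m → Set) → Set
Isolates {m} (hyp S a) P =
  ((x : Vec ℕ m) → P x → sumOver S x ≤ a) ⊎ ((x : Vec ℕ m) → P x → a ≤ sumOver S x)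

-- Affine dimension of the convex hull of a set P of integer points.
-- Integer vectors are affinely independent over ℝ iff no nontrivial
-- integer combination of the differences vanishes.

∑ : ∀ {n} → (Fin n → ℤ) → ℤ
∑ {zero}  f = pos 0
∑ {suc n} f = f zero ℤ.+ ∑ (λ t → f (suc t))

AffIndep : ∀ {m d} → (Fin (suc d) → Vec ℕ m) → Set
AffIndep {m} {d} v =
  (c : Fin d → ℤ) →
  ((j : Fin m) → ∑ (λ t → c t ℤ.* (pos (lookup (v (suc t)) j) ℤ.- pos (lookup (v zero) j))) ≡ pos 0) →
  (t : Fin d) → c t ≡ pos 0

DimAtLeast : ∀ {m} → (Vec ℕ m → Set) → ℕ → Set
DimAtLeast {m} P d = Σ (Fin (suc d) → Vec ℕ m) λ v → ((t : Fin (suc d)) → P (v t)) × AffIndep v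

DimEq : ∀ {m} → (Vec ℕ m → Set) → ℕ → Set
DimEq P d = DimAtLeast P d × ¬ DimAtLeast P (suc d)

-- conv(P) ∩ H = conv(P ∩ H) when H isolates P
_∩H_ : ∀ {m} → (Vec ℕ m → Set) → Hyp m → (Vec ℕ m → Set)
(P ∩H H) x = P x × OnHyp H x

-- H is facet-defining for the m-dimensional polytope conv(P)
FacetDefining : ∀ {m} → Hyp m → (Vec ℕ m → Set) → Set
FacetDefining {m} H P = Isolates H P × DimEq (P ∩H H) (m ∸ 1)

DefinesFacet : ∀ {m} → Hyp m → (Vec ℕ m → Set) → Set
DefinesFacet {m} (hyp S a) P =
  ((x : Vec ℕ m) → P x → sumOver S x ≤ a) ×
  (Σ ℕ λ d → DimEq P (suc d) × DimEq (P ∩H hyp S a) d)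

𝒥 : ∀ {m} → Vec ℕ m → Fin m → Hyp m
𝒥 lam j = hyp (∁ ⁅ j ⁆) (∣ lam ∣ᵥ ∸ headℕ (toList lam))

{-# OPTIONS --safe #-}
-- Call a partition μ with λ ⊆ μ and μ_i ≤ λ_i + h(i-1) admissible. Every admissible μ has b_{h,λμ} ≠ 0, and
-- the sign of a term of G only depends on its degree, so supp s_μ ⊆ supp G for every admissible μ; in
-- particular this holds for all members of the dominating sequence. A facet F of Newt(s_μ) spans an
-- (m-2)-dimensional affine space in one degree, so it suffices to find one point of supp G on H(F) of
-- another degree. Permuting the parts of an admissible ν of size |μ| ± 1 gives a point with
-- Σ_{i∈I} x_i = ν_1 + … + ν_|I| and Σ_{i∉I} x_i = ν_{|I|+1} + … + ν_m.
-- If H(F)₁ isolates, then Newt(G) lies on the side ≤ L, because F is a proper face. Take ν by removing a box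
-- from row m if μ_m > 0, and by adding a box in the first empty row otherwise; isolation gives equality.
-- If H(F)₀ isolates and μ ≠ λ, remove a box from the last row with μ_i > λ_i. If μ = λ, add a box in the
-- first row r ≤ |I| with λ_r < λ_1. When there is no such row, all points of F have x_i = λ_1 for i ∈ I,
-- so |I| = 1 by the dimension of F, and H(F)₀ is some 𝒥_j.
module Submission where

open import Defs
open import Data.Bool using (Bool; true; false; T; T?; _∧_; if_then_else_)
open import Data.Bool.Properties using (T-∧; T-≡)
open import Data.Nat using (ℕ; zero; suc; pred; _⊓_; _+_; _*_; _∸_; _≤_; _<_; _≥_; z≤n; s≤s; z<s; s≤s⁻¹; _<ᵇ_; _≤ᵇ_; _≡ᵇ_; _≤′_; ≤′-refl; ≤′-step)
open import Data.Nat.Properties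
open import Data.Nat.ListAction using (sum)
open import Data.Nat.ListAction.Properties using (sum-++)
open import Data.Nat.Tactic.RingSolver using (solve-∀)
open import Data.Integer using (ℤ; 0ℤ; 1ℤ; -1ℤ)
  renaming (+_ to pos; _+_ to _+ᶻ_; _*_ to _*ᶻ_; _-_ to _-ᶻ_; -_ to -ᶻ_; _≟_ to _≟ᶻ_)
import Data.Integer.Properties as ℤₚ
import Data.Integer.Tactic.RingSolver as ℤ-Solver
open import Data.Fin as Fin using (Fin; zero; suc; toℕ; fromℕ; inject₁; punchIn; punchOut)
import Data.Fin.Properties as Finₚ
open import Data.Fin.Subset using (Subset; Nonempty; ∁; ∣_∣; ⁅_⁆; ⊤; ⊥) renaming (_∈_ to _∈ₛ_)
open import Data.Fin.Subset.Properties
open import Data.List as List using (List; []; _∷_; [_]; _++_; length; concat; concatMap; replicate; applyUpTo; take; drop; _∷ʳ′_; allFin)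
open import Data.List.Properties using (applyUpTo-∷ʳ; ++-identityʳ; length-++; length-take; length-drop; take++drop≡id; ∷-injectiveˡ; ∷-injectiveʳ)
open import Data.List.Membership.Propositional using (_∈_; find)
open import Data.List.Membership.Propositional.Properties
open import Data.List.Relation.Unary.All as All using (All; []; _∷_)
import Data.List.Relation.Unary.All.Properties as All
open import Data.List.Relation.Unary.Any as Any using (here; there)
open import Data.List.Relation.Unary.Linked using (Linked; []; [-]; _∷_)
open import Data.List.Relation.Binary.Pointwise using (Pointwise; []; _∷_)
open import Data.List.Relation.Binary.Permutation.Propositional using (_↭_; prep; swap; ↭-refl; ↭-sym; ↭-trans; ↭-reflexive)
open import Data.List.Relation.Binary.Permutation.Propositional.Properties using (∈-resp-↭; drop-mid; ↭-length; ↭-empty-inv; shift; ∷↭∷ʳ)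
open import Data.Vec as Vec using (Vec; []; _∷_; _∷ʳ_; lookup; toList; tabulate; updateAt; insertAt; initLast; here; there)
open import Data.Vec.Properties using (toList-map; length-toList; toList-∷ʳ; lookup∘updateAt; lookup∘updateAt′; lookup∘tabulate; tabulate∘lookup; tabulate-cong)
open import Data.Maybe using (just; nothing)
open import Data.Product using (Σ; ∃; _×_; _,_; proj₁; proj₂)
open import Data.Sum using (_⊎_; inj₁; inj₂)
import Data.Unit as Unit
open import Function using (_∘_; const; Equivalence)
open import Relation.Nullary using (¬_; Dec; contradiction; yes; no; ¬?; _×-dec_)
open import Relation.Nullary.Decidable using (decidable-stable)
open import Relation.Binary.PropositionalEquality hiding ([_])

open Equivalence using (to; from)

private
  variable
    m n d : ℕ
    A B C : Set

-- Linear algebra over ℤ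

∑-cong : {f g : Fin n → ℤ} → (∀ t → f t ≡ g t) → ∑ f ≡ ∑ g
∑-cong {zero}  f≗g = refl
∑-cong {suc n} f≗g = cong₂ _+ᶻ_ (f≗g zero) (∑-cong (f≗g ∘ suc))

∑-zero : {f : Fin n → ℤ} → (∀ t → f t ≡ 0ℤ) → ∑ f ≡ 0ℤ
∑-zero {zero}  f≗0 = refl
∑-zero {suc n} f≗0 = cong₂ _+ᶻ_ (f≗0 zero) (∑-zero (f≗0 ∘ suc))

∑-distrib-+ : (f g : Fin n → ℤ) → ∑ (λ t → f t +ᶻ g t) ≡ ∑ f +ᶻ ∑ g
∑-distrib-+ {zero}  f g = refl
∑-distrib-+ {suc n} f g = trans (cong (f zero +ᶻ g zero +ᶻ_) (∑-distrib-+ (f ∘ suc) (g ∘ suc)))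
                                (lemma (f zero) (g zero) _ _)
  where
  lemma : ∀ a b c e → a +ᶻ b +ᶻ (c +ᶻ e) ≡ a +ᶻ c +ᶻ (b +ᶻ e)
  lemma = ℤ-Solver.solve-∀

*-distribˡ-∑ : (a : ℤ) (f : Fin n → ℤ) → ∑ (λ t → a *ᶻ f t) ≡ a *ᶻ ∑ f
*-distribˡ-∑ {zero}  a f = sym (ℤₚ.*-zeroʳ a)
*-distribˡ-∑ {suc n} a f = trans (cong (a *ᶻ f zero +ᶻ_) (*-distribˡ-∑ a (f ∘ suc)))
                                 (sym (ℤₚ.*-distribˡ-+ a (f zero) _))

∑-swap : (f : Fin m → Fin n → ℤ) → ∑ (λ i → ∑ (f i)) ≡ ∑ (λ j → ∑ (λ i → f i j))
∑-swap {zero}  {n} f = sym (∑-zero {n} λ _ → refl)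
∑-swap {suc m} {n} f = trans (cong (∑ (f zero) +ᶻ_) (∑-swap (f ∘ suc)))
                             (sym (∑-distrib-+ (f zero) _))

-- Gaussian elimination: clear the coordinate p of all later vectors with the first one.
linearlyDependent : n < d → (w : Fin d → Fin n → ℤ) →
  Σ (Fin d → ℤ) λ c → (∀ j → ∑ (λ t → c t *ᶻ w t j) ≡ 0ℤ) × ∃ λ t → c t ≢ 0ℤ
linearlyDependent {zero}  {suc d} _   w = const 1ℤ , (λ ()) , zero , λ ()
linearlyDependent {suc n} {suc d} n<d w with Finₚ.any? (λ j → ¬? (w zero j ≟ᶻ 0ℤ))
... | no  w₀≡0 = c , relation , zero , λ ()
  where
  c : Fin (suc d) → ℤ
  c zero    = 1ℤ
  c (suc _) = 0ℤ
  relation : ∀ j → ∑ (λ t → c t *ᶻ w t j) ≡ 0ℤ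
  relation j = ∑-zero {f = λ t → c t *ᶻ w t j} λ where
    zero    → trans (ℤₚ.*-identityˡ _) (decidable-stable (w zero j ≟ᶻ 0ℤ) (λ ≢0 → w₀≡0 (j , ≢0)))
    (suc t) → refl
... | yes (p , a≢0) = c , relation , suc (proj₁ nontrivial) , c≢0
  where
  a = w zero p
  -- Scaling by the pivot instead of dividing by it stays within ℤ. Coordinate `p` of the result is
  -- 0, so the recursion can omit it.
  reduced : Fin d → Fin (suc n) → ℤ
  reduced t j = a *ᶻ w (suc t) j -ᶻ w (suc t) p *ᶻ w zero j
  ih = linearlyDependent (s≤s⁻¹ n<d) (λ t i → reduced t (punchIn p i))
  c′ = proj₁ ih
  nontrivial = proj₂ (proj₂ ih)
  c : Fin (suc d) → ℤ
  -- This coefficient collects the multiples of `w zero` that were subtracted in `reduced`.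
  c zero    = -ᶻ ∑ (λ t → c′ t *ᶻ w (suc t) p)
  c (suc t) = a *ᶻ c′ t
  c≢0 : c (suc (proj₁ nontrivial)) ≢ 0ℤ
  c≢0 eq with ℤₚ.i*j≡0⇒i≡0∨j≡0 a eq
  ... | inj₁ a≡0 = a≢0 a≡0
  ... | inj₂ ≡0  = proj₂ nontrivial ≡0
  reduced-relation : ∀ j → ∑ (λ t → c′ t *ᶻ reduced t j) ≡ 0ℤ
  reduced-relation j with p Finₚ.≟ j
  ... | yes refl = ∑-zero λ t → lemma (c′ t) a (w (suc t) j)
    where
    lemma : ∀ x y z → x *ᶻ (y *ᶻ z -ᶻ z *ᶻ y) ≡ 0ℤ
    lemma = ℤ-Solver.solve-∀
  ... | no p≢j = subst (λ i → ∑ (λ t → c′ t *ᶻ reduced t i) ≡ 0ℤ) (Finₚ.punchIn-punchOut p≢j)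
                   (proj₁ (proj₂ ih) (punchOut p≢j))
  relation : ∀ j → ∑ (λ t → c t *ᶻ w t j) ≡ 0ℤ
  relation j = begin
    c zero *ᶻ w zero j +ᶻ ∑ (λ t → a *ᶻ c′ t *ᶻ w (suc t) j)
      ≡⟨ cong (_+ᶻ ∑ (λ t → a *ᶻ c′ t *ᶻ w (suc t) j)) (lemma₁ (∑ (λ t → c′ t *ᶻ w (suc t) p)) (w zero j)) ⟩
    (-ᶻ w zero j) *ᶻ ∑ (λ t → c′ t *ᶻ w (suc t) p) +ᶻ ∑ (λ t → a *ᶻ c′ t *ᶻ w (suc t) j)
      ≡⟨ cong (_+ᶻ ∑ (λ t → a *ᶻ c′ t *ᶻ w (suc t) j)) (*-distribˡ-∑ (-ᶻ w zero j) (λ t → c′ t *ᶻ w (suc t) p)) ⟨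
    ∑ (λ t → (-ᶻ w zero j) *ᶻ (c′ t *ᶻ w (suc t) p)) +ᶻ ∑ (λ t → a *ᶻ c′ t *ᶻ w (suc t) j)
      ≡⟨ ∑-distrib-+ (λ t → (-ᶻ w zero j) *ᶻ (c′ t *ᶻ w (suc t) p)) (λ t → a *ᶻ c′ t *ᶻ w (suc t) j) ⟨
    ∑ (λ t → (-ᶻ w zero j) *ᶻ (c′ t *ᶻ w (suc t) p) +ᶻ a *ᶻ c′ t *ᶻ w (suc t) j)
      ≡⟨ ∑-cong (λ t → lemma₂ (w zero j) (c′ t) (w (suc t) p) a (w (suc t) j)) ⟩
    ∑ (λ t → c′ t *ᶻ reduced t j)
      ≡⟨ reduced-relation j ⟩
    0ℤ ∎
    where
    open ≡-Reasoning
    lemma₁ : ∀ s x → (-ᶻ s) *ᶻ x ≡ (-ᶻ x) *ᶻ s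
    lemma₁ = ℤ-Solver.solve-∀
    lemma₂ : ∀ x c y a z → (-ᶻ x) *ᶻ (c *ᶻ y) +ᶻ a *ᶻ c *ᶻ z ≡ c *ᶻ (a *ᶻ z -ᶻ y *ᶻ x)
    lemma₂ = ℤ-Solver.solve-∀

-- Affine dimension and linear functionals

dot : (Fin m → ℤ) → Vec ℕ m → ℤ
dot u x = ∑ (λ j → u j *ᶻ pos (lookup x j))

difference : Vec ℕ m → Vec ℕ m → Fin m → ℤ
difference x y j = pos (lookup x j) -ᶻ pos (lookup y j)

∑-difference : (u : Fin m → ℤ) (x y : Vec ℕ m) →
  ∑ (λ j → u j *ᶻ difference x y j) ≡ dot u x -ᶻ dot u y
∑-difference u x y = begin
  ∑ (λ j → u j *ᶻ difference x y j)
    ≡⟨ ∑-cong (λ j → lemma (u j) (pos (lookup x j)) (pos (lookup y j))) ⟩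
  ∑ (λ j → u j *ᶻ pos (lookup x j) +ᶻ -1ℤ *ᶻ (u j *ᶻ pos (lookup y j)))
    ≡⟨ ∑-distrib-+ (λ j → u j *ᶻ pos (lookup x j)) (λ j → -1ℤ *ᶻ (u j *ᶻ pos (lookup y j))) ⟩
  dot u x +ᶻ ∑ (λ j → -1ℤ *ᶻ (u j *ᶻ pos (lookup y j)))
    ≡⟨ cong (dot u x +ᶻ_) (*-distribˡ-∑ -1ℤ (λ j → u j *ᶻ pos (lookup y j))) ⟩
  dot u x +ᶻ -1ℤ *ᶻ dot u y
    ≡⟨ cong (dot u x +ᶻ_) (ℤₚ.-1*i≡-i (dot u y)) ⟩
  dot u x -ᶻ dot u y ∎
  where
  open ≡-Reasoning
  lemma : ∀ a b c → a *ᶻ (b -ᶻ c) ≡ a *ᶻ b +ᶻ -1ℤ *ᶻ (a *ᶻ c)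
  lemma = ℤ-Solver.solve-∀

-- The new point takes index 1, not 0, so that the base point of the differences stays the same.
insertPoint : Vec ℕ m → (Fin (suc d) → Vec ℕ m) → Fin (suc (suc d)) → Vec ℕ m
insertPoint y v zero          = v zero
insertPoint y v (suc zero)    = y
insertPoint y v (suc (suc t)) = v (suc t)

-- Applying `u` to an affine relation kills every term except that of `y`, whose coefficient must
-- therefore vanish. What remains is a relation between the old points.
affIndep-insert : (v : Fin (suc d) → Vec ℕ m) → AffIndep v → (u : Fin m → ℤ) (y : Vec ℕ m) →
  (∀ t → dot u (v (suc t)) ≡ dot u (v zero)) → dot u y ≢ dot u (v zero) → AffIndep (insertPoint y v)
affIndep-insert v indep u y constant differs c relation = λ where
    zero    → c₀≡0
    (suc t) → indep (c ∘ suc) rest t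
  where
  open ≡-Reasoning
  w : Fin _ → Fin _ → ℤ
  w t = difference (insertPoint y v (suc t)) (v zero)
  combined : ∑ (λ t → c t *ᶻ (dot u (insertPoint y v (suc t)) -ᶻ dot u (v zero))) ≡ 0ℤ
  combined = begin
    ∑ (λ t → c t *ᶻ (dot u (insertPoint y v (suc t)) -ᶻ dot u (v zero)))
      ≡⟨ ∑-cong (λ t → cong (c t *ᶻ_) (∑-difference u (insertPoint y v (suc t)) (v zero))) ⟨
    ∑ (λ t → c t *ᶻ ∑ (λ j → u j *ᶻ w t j))
      ≡⟨ ∑-cong (λ t → *-distribˡ-∑ (c t) (λ j → u j *ᶻ w t j)) ⟨
    ∑ (λ t → ∑ (λ j → c t *ᶻ (u j *ᶻ w t j)))
      ≡⟨ ∑-swap (λ t j → c t *ᶻ (u j *ᶻ w t j)) ⟩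
    ∑ (λ j → ∑ (λ t → c t *ᶻ (u j *ᶻ w t j)))
      ≡⟨ ∑-cong (λ j → ∑-cong (λ t → lemma (c t) (u j) (w t j))) ⟩
    ∑ (λ j → ∑ (λ t → u j *ᶻ (c t *ᶻ w t j)))
      ≡⟨ ∑-zero (λ j → trans (*-distribˡ-∑ (u j) (λ t → c t *ᶻ w t j))
           (trans (cong (u j *ᶻ_) (relation j)) (ℤₚ.*-zeroʳ (u j)))) ⟩
    0ℤ ∎
    where
    lemma : ∀ a b e → a *ᶻ (b *ᶻ e) ≡ b *ᶻ (a *ᶻ e)
    lemma = ℤ-Solver.solve-∀
  c₀*≡0 : c zero *ᶻ (dot u y -ᶻ dot u (v zero)) ≡ 0ℤ
  c₀*≡0 = begin
    c zero *ᶻ (dot u y -ᶻ dot u (v zero))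
      ≡⟨ ℤₚ.+-identityʳ _ ⟨
    c zero *ᶻ (dot u y -ᶻ dot u (v zero)) +ᶻ 0ℤ
      ≡⟨ cong (c zero *ᶻ (dot u y -ᶻ dot u (v zero)) +ᶻ_)
           (∑-zero (λ t → trans (cong (c (suc t) *ᶻ_) (ℤₚ.i≡j⇒i-j≡0 (constant t)))
                                (ℤₚ.*-zeroʳ (c (suc t))))) ⟨
    _ ≡⟨ combined ⟩
    0ℤ ∎
  c₀≡0 : c zero ≡ 0ℤ
  c₀≡0 with ℤₚ.i*j≡0⇒i≡0∨j≡0 (c zero) c₀*≡0
  ... | inj₁ ≡0 = ≡0
  ... | inj₂ ≡0 = contradiction (ℤₚ.i-j≡0⇒i≡j _ _ ≡0) differs
  rest : ∀ j → ∑ (λ t → c (suc t) *ᶻ w (suc t) j) ≡ 0ℤ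
  rest j = trans (sym (ℤₚ.+-identityˡ _))
    (trans (cong (_+ᶻ ∑ (λ t → c (suc t) *ᶻ w (suc t) j)) (sym (cong (_*ᶻ w zero j) c₀≡0))) (relation j))

-- The tool for all dimension counts: it enlarges a face by one dimension, and it refutes too large
-- a dimension by producing more independent points than the space admits.
dimAtLeast-insert : {P Q : Vec ℕ m → Set} (u : Fin m → ℤ) (a : ℤ) → (∀ {x} → P x → dot u x ≡ a) →
  (∀ {x} → P x → Q x) → (y : Vec ℕ m) → Q y → dot u y ≢ a → DimAtLeast P d → DimAtLeast Q (suc d)
dimAtLeast-insert {Q = Q} u a constant P⊆Q y Qy differs (v , Pv , indep) =
  insertPoint y v , Qv , affIndep-insert v indep u y
    (λ t → trans (constant (Pv (suc t))) (sym (constant (Pv zero))))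
    (λ eq → differs (trans eq (constant (Pv zero))))
  where
  Qv : ∀ t → Q (insertPoint y v t)
  Qv zero          = P⊆Q (Pv zero)
  Qv (suc zero)    = Qy
  Qv (suc (suc t)) = P⊆Q (Pv (suc t))

dimAtLeast-⊆ : {P Q : Vec ℕ m → Set} → (∀ {x} → P x → Q x) → DimAtLeast P d → DimAtLeast Q d
dimAtLeast-⊆ P⊆Q (v , Pv , indep) = v , P⊆Q ∘ Pv , indep

-- The point at index 1 is dropped, which keeps the base point; its coefficient is padded with 0.
dimAtLeast-pred : {P : Vec ℕ m → Set} → DimAtLeast P (suc d) → DimAtLeast P d
dimAtLeast-pred {d = d} (v , Pv , indep) = v ∘ skip , Pv ∘ skip , λ c relation t →
    indep (pad c) (λ j → trans (ℤₚ.+-identityˡ _) (relation j)) (suc t)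
  where
  skip : Fin (suc d) → Fin (suc (suc d))
  skip = punchIn (suc zero)
  pad : (Fin d → ℤ) → Fin (suc d) → ℤ
  pad c zero    = 0ℤ
  pad c (suc t) = c t

dimAtLeast-≤ : {P : Vec ℕ m → Set} {e : ℕ} → e ≤ d → DimAtLeast P d → DimAtLeast P e
dimAtLeast-≤ {P = P} e≤d = go (≤⇒≤′ e≤d)
  where
  go : ∀ {e d} → e ≤′ d → DimAtLeast P d → DimAtLeast P e
  go ≤′-refl       = λ p → p
  go (≤′-step e≤d) = go e≤d ∘ dimAtLeast-pred {P = P}

-- More than `m` difference vectors in ℤ^m satisfy a nontrivial relation.
¬dimAtLeast-suc : {P : Vec ℕ m → Set} → ¬ DimAtLeast P (suc m)
¬dimAtLeast-suc {m} (v , _ , indep) =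
  let c , relation , t , c≢0 = linearlyDependent (n<1+n m) (λ t → difference (v (suc t)) (v zero))
  in c≢0 (indep c relation t)

-- Counting

bit : Bool → ℕ
bit b = if b then 1 else 0

count-∷ : (p : A → Bool) (x : A) (xs : List A) → count p (x ∷ xs) ≡ bit (p x) + count p xs
count-∷ p x xs with p x
... | true  = refl
... | false = refl

count-++ : (p : A → Bool) (xs ys : List A) → count p (xs ++ ys) ≡ count p xs + count p ys
count-++ p []       ys = refl
count-++ p (x ∷ xs) ys with p x
... | true  = cong suc (count-++ p xs ys)
... | false = count-++ p xs ys

count-replicate : (p : A → Bool) (n : ℕ) (x : A) → count p (replicate n x) ≡ n * bit (p x)
count-replicate p zero    x = refl
count-replicate p (suc n) x = trans (count-∷ p x (replicate n x)) (cong (bit (p x) +_) (count-replicate p n x))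

count≤length : (p : A → Bool) (xs : List A) → count p xs ≤ length xs
count≤length p []       = z≤n
count≤length p (x ∷ xs) with p x
... | true  = s≤s (count≤length p xs)
... | false = m≤n⇒m≤1+n (count≤length p xs)

count-all : (p : A → Bool) {xs : List A} → All (λ x → p x ≡ true) xs → count p xs ≡ length xs
count-all p []                  = refl
count-all p {x ∷ xs} (px ∷ pxs) rewrite px = cong suc (count-all p pxs)

count-none : (p : A → Bool) {xs : List A} → All (λ x → p x ≡ false) xs → count p xs ≡ 0
count-none p []                  = refl
count-none p {x ∷ xs} (px ∷ pxs) rewrite px = count-none p pxs

count-∈ : (p : A → Bool) {x : A} {xs : List A} → x ∈ xs → T (p x) → count p xs ≢ 0
count-∈ p {x} (here refl) px with p x
... | true = λ ()
count-∈ p {xs = y ∷ _} (there x∈xs) px with p y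
... | true  = λ ()
... | false = count-∈ p x∈xs px

count≢0 : (p : A → Bool) (xs : List A) → count p xs ≢ 0 → ∃ λ x → x ∈ xs × T (p x)
count≢0 p []       ≢0 = contradiction refl ≢0
count≢0 p (x ∷ xs) ≢0 with p x in eq
... | true  = x , here refl , from T-≡ eq
... | false = let y , y∈xs , py = count≢0 p xs ≢0 in y , there y∈xs , py

bit-≤ᵇ-suc : ∀ e k → bit (e ≤ᵇ suc k) ≡ bit (e ≤ᵇ k) + bit (e ≡ᵇ suc k)
bit-≤ᵇ-suc zero          k       = refl
bit-≤ᵇ-suc (suc zero)    zero    = refl
bit-≤ᵇ-suc (suc zero)    (suc k) = refl
bit-≤ᵇ-suc (suc (suc e)) zero    = refl
bit-≤ᵇ-suc (suc (suc e)) (suc k) = bit-≤ᵇ-suc (suc e) k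

count-≤-suc : ∀ k es → count (_≤ᵇ suc k) es ≡ count (_≤ᵇ k) es + count (_≡ᵇ suc k) es
count-≤-suc k []       = refl
count-≤-suc k (e ∷ es) = begin
  count (_≤ᵇ suc k) (e ∷ es)
    ≡⟨ count-∷ (_≤ᵇ suc k) e es ⟩
  bit (e ≤ᵇ suc k) + count (_≤ᵇ suc k) es
    ≡⟨ cong₂ _+_ (bit-≤ᵇ-suc e k) (count-≤-suc k es) ⟩
  bit (e ≤ᵇ k) + bit (e ≡ᵇ suc k) + (count (_≤ᵇ k) es + count (_≡ᵇ suc k) es)
    ≡⟨ lemma (bit (e ≤ᵇ k)) (bit (e ≡ᵇ suc k)) (count (_≤ᵇ k) es) (count (_≡ᵇ suc k) es) ⟩
  bit (e ≤ᵇ k) + count (_≤ᵇ k) es + (bit (e ≡ᵇ suc k) + count (_≡ᵇ suc k) es)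
    ≡⟨ cong₂ _+_ (count-∷ (_≤ᵇ k) e es) (count-∷ (_≡ᵇ suc k) e es) ⟨
  count (_≤ᵇ k) (e ∷ es) + count (_≡ᵇ suc k) (e ∷ es) ∎
  where
  open ≡-Reasoning
  lemma : ∀ a b c d → a + b + (c + d) ≡ a + c + (b + d)
  lemma = solve-∀

-- Membership in the enumerations

∈-range⁺ : ∀ {lo hi v} → lo ≤ v → v ≤ hi → v ∈ range lo hi
∈-range⁺ {lo} {hi} lo≤v v≤hi =
  subst (_∈ range lo hi) (m+[n∸m]≡n lo≤v) (∈-map⁺ (lo +_) (∈-upTo⁺ (∸-monoˡ-< (s≤s v≤hi) lo≤v)))

∈-range⁻ : ∀ {lo hi v} → v ∈ range lo hi → lo ≤ v × v ≤ hi
∈-range⁻ {lo} {hi} v∈ with d , d∈ , refl ← ∈-map⁻ (lo +_) v∈ =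
  m≤m+n lo d , s≤s⁻¹ (≤-trans (≤-reflexive (sym (+-suc lo d)))
    (≤-trans (+-monoʳ-≤ lo (∈-upTo⁻ d∈)) (≤-reflexive (m+[n∸m]≡n (<⇒≤ lo<hi)))))
  where
  lo<hi : lo < suc hi
  lo<hi = m∸n≢0⇒n<m λ eq → contradiction (≤-trans (∈-upTo⁻ d∈) (≤-reflexive eq)) λ ()

∈-concatMap-map⁺ : (c : A → B → C) (f : A → List B) {xs : List A} {x : A} {y : B} →
  x ∈ xs → y ∈ f x → c x y ∈ concatMap (λ x → List.map (c x) (f x)) xs
∈-concatMap-map⁺ c f x∈xs y∈fx = ∈-concatMap⁺ (λ x → List.map (c x) (f x))
  (Any.map (λ where refl → ∈-map⁺ (c _) y∈fx) x∈xs)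

∈-concatMap-map⁻ : (c : A → B → C) (f : A → List B) (xs : List A) {z : C} →
  z ∈ concatMap (λ x → List.map (c x) (f x)) xs → ∃ λ x → ∃ λ y → x ∈ xs × y ∈ f x × z ≡ c x y
∈-concatMap-map⁻ c f xs z∈ =
  let x , x∈xs , z∈′ = find (∈-concatMap⁻ (λ x → List.map (c x) (f x)) {xs = xs} z∈)
      y , y∈ , eq = ∈-map⁻ (c x) z∈′
  in x , y , x∈xs , y∈ , eq

-- Together with `ColumnStrict` this describes a semistandard tableau with the given row lengths and
-- entries in 1, ..., `hi`.
Rows : ℕ → List (List ℕ) → List ℕ → Set
Rows hi = Pointwise (λ r k → r ∈ weakInc 1 hi k)

∈-choices⁺ : (f : A → List B) {rows : List B} {ks : List A} →
  Pointwise (λ r k → r ∈ f k) rows ks → rows ∈ choices (List.map f ks)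
∈-choices⁺ f []         = here refl
∈-choices⁺ f (r∈ ∷ rs∈) = ∈-concatMap-map⁺ _∷_ _ r∈ (∈-choices⁺ f rs∈)

∈-choices⁻ : (f : A → List B) {rows : List B} (ks : List A) →
  rows ∈ choices (List.map f ks) → Pointwise (λ r k → r ∈ f k) rows ks
∈-choices⁻ f []       (here refl) = []
∈-choices⁻ f (k ∷ ks) rows∈ with r , rs , r∈ , rs∈ , refl ← ∈-concatMap-map⁻ _∷_ _ (f k) rows∈ =
  r∈ ∷ ∈-choices⁻ f ks rs∈

weakInc-length : ∀ {lo hi r} n → r ∈ weakInc lo hi n → length r ≡ n
weakInc-length zero    (here refl) = refl
weakInc-length {lo} {hi} (suc n) r∈ with _ , _ , _ , r∈ , refl ← ∈-concatMap-map⁻ _∷_ _ (range lo hi) r∈ =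
  cong suc (weakInc-length n r∈)

weakInc-bounds : ∀ {lo hi r} n → r ∈ weakInc lo hi n → All (λ e → lo ≤ e × e ≤ hi) r
weakInc-bounds zero    (here refl) = []
weakInc-bounds {lo} {hi} (suc n) r∈ with _ , _ , v∈ , r∈ , refl ← ∈-concatMap-map⁻ _∷_ _ (range lo hi) r∈ =
  let lo≤v , v≤hi = ∈-range⁻ v∈
  in (lo≤v , v≤hi) ∷ All.map (λ (v≤e , e≤hi) → ≤-trans lo≤v v≤e , e≤hi) (weakInc-bounds n r∈)

replicate-∈-weakInc : ∀ {lo hi} k → lo ≤ hi → replicate k hi ∈ weakInc lo hi k
replicate-∈-weakInc zero    lo≤hi = here refl
replicate-∈-weakInc (suc k) lo≤hi = ∈-concatMap-map⁺ _∷_ _ (∈-range⁺ lo≤hi ≤-refl) (replicate-∈-weakInc k ≤-refl)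

weakInc-extend : ∀ {lo hi r} n k → lo ≤ suc hi → r ∈ weakInc lo hi n →
  r ++ replicate k (suc hi) ∈ weakInc lo (suc hi) (n + k)
weakInc-extend zero    k lo≤ (here refl) = replicate-∈-weakInc k lo≤
weakInc-extend {lo} {hi} (suc n) k lo≤ r∈ with _ , _ , v∈ , r∈ , refl ← ∈-concatMap-map⁻ _∷_ _ (range lo hi) r∈ =
  let lo≤v , v≤hi = ∈-range⁻ v∈
  in ∈-concatMap-map⁺ _∷_ _ (∈-range⁺ lo≤v (m≤n⇒m≤1+n v≤hi)) (weakInc-extend n k (m≤n⇒m≤1+n v≤hi) r∈)

-- Tableaux

ColumnStrict : List (List ℕ) → Set
ColumnStrict = Linked (λ t b → T (strictAbove t b))

strictAbove-[] : ∀ t → T (strictAbove t [])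
strictAbove-[] []      = _
strictAbove-[] (_ ∷ _) = _

-- The length bound places each appended `suc M` under an old entry of `t`, which is at most `M`,
-- and never under an entry of `X`.
strictAbove-extend : ∀ {M} t b k X → length b + k ≤ length t → All (_≤ M) t →
  T (strictAbove t b) → T (strictAbove (t ++ X) (b ++ replicate k (suc M)))
strictAbove-extend t       []      zero    X _ _ _ = strictAbove-[] (t ++ X)
strictAbove-extend []      []      (suc k) X ()
strictAbove-extend []      (_ ∷ _) k       X ()
strictAbove-extend (t ∷ ts) []      (suc k) X (s≤s k≤) (t≤M ∷ ts≤M) _ =
  from T-∧ (<⇒<ᵇ (s≤s t≤M) , strictAbove-extend ts [] k X k≤ ts≤M (strictAbove-[] ts))
strictAbove-extend (t ∷ ts) (b ∷ bs) k X (s≤s k≤) (t≤M ∷ ts≤M) st =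
  let t<b , st′ = to T-∧ st in from T-∧ (t<b , strictAbove-extend ts bs k X k≤ ts≤M st′)

-- Strip μ ν: μ/ν is a horizontal strip, where ν has one row less than μ.
data Strip : List ℕ → List ℕ → Set where
  last : ∀ {a} → Strip (a ∷ []) []
  _∷_  : ∀ {a b c μ ν} → c ≤ b × b ≤ a → Strip (c ∷ μ) ν → Strip (a ∷ c ∷ μ) (b ∷ ν)

strip-linked : ∀ {μ ν} → Strip μ ν → Linked _≥_ ν
strip-linked last                              = []
strip-linked (_ ∷ last)                        = [-]
strip-linked ((c≤b , _) ∷ s@((_ , b′≤c) ∷ _)) = ≤-trans b′≤c c≤b ∷ strip-linked s

-- Rows before the deleted part are unchanged and later ones move up by one, so each interlacing
-- condition is an equality on one side and the decrease of the parts on the other.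
strip-remove : ∀ xs {x ys} → Linked _≥_ (xs ++ x ∷ ys) → Strip (xs ++ x ∷ ys) (xs ++ ys)
strip-remove []           {ys = []}    _            = last
strip-remove []           {ys = _ ∷ _} (y≤x ∷ lnk) = (≤-refl , y≤x) ∷ strip-remove [] lnk
strip-remove (_ ∷ [])     (x≤a ∷ lnk)              = (x≤a , ≤-refl) ∷ strip-remove [] lnk
strip-remove (_ ∷ b ∷ xs) (b≤a ∷ lnk)              = (b≤a , ≤-refl) ∷ strip-remove (b ∷ xs) lnk

-- The boxes of the strip receive the letter `M`. The last row of the larger shape has no
-- counterpart and consists of `M` only.
fillStrip : ℕ → List ℕ → List ℕ → List (List ℕ) → List (List ℕ)
fillStrip M (a ∷ μ) (b ∷ ν) (r ∷ rs) = (r ++ replicate (a ∸ b) M) ∷ fillStrip M μ ν rs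
fillStrip M (a ∷ _) _       _        = replicate a M ∷ []
fillStrip M []      _       _        = []

fillStrip-rows : ∀ {n μ ν rows} → Strip μ ν → Rows n rows ν → Rows (suc n) (fillStrip (suc n) μ ν rows) μ
fillStrip-rows last               []        = replicate-∈-weakInc _ (s≤s z≤n) ∷ []
fillStrip-rows {n} (_∷_ {a} {b} (_ , b≤a) s) (_∷_ {r} r∈ rs∈) =
  subst (λ k → r ++ replicate (a ∸ b) (suc n) ∈ weakInc 1 (suc n) k) (m+[n∸m]≡n b≤a)
    (weakInc-extend b (a ∸ b) (s≤s z≤n) r∈)
  ∷ fillStrip-rows s rs∈

fillStrip-columns : ∀ {n μ ν rows} → Strip μ ν → Rows n rows ν → ColumnStrict rows →
  ColumnStrict (fillStrip (suc n) μ ν rows)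
fillStrip-columns last [] _ = [-]
fillStrip-columns (_∷_ {a} {b} {c} (c≤b , _) last) (_∷_ {r} r∈ []) _ =
  strictAbove-extend r [] c (replicate (a ∸ b) _)
    (≤-trans c≤b (≤-reflexive (sym (weakInc-length b r∈))))
    (All.map proj₂ (weakInc-bounds b r∈)) (strictAbove-[] r)
  ∷ [-]
fillStrip-columns (_∷_ {a} {b} {c} (c≤b , _) s@(_∷_ {b = b′} (_ , b′≤c) _))
                  (_∷_ {r} r∈ rs∈@(_∷_ {r′} r′∈ _)) (r<r′ ∷ incr) =
  strictAbove-extend r r′ (c ∸ b′) (replicate (a ∸ b) _)
    (≤-trans (≤-reflexive (trans (cong (_+ (c ∸ b′)) (weakInc-length b′ r′∈)) (m+[n∸m]≡n b′≤c)))
             (≤-trans c≤b (≤-reflexive (sym (weakInc-length b r∈)))))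
    (All.map proj₂ (weakInc-bounds b r∈)) r<r′
  ∷ fillStrip-columns s rs∈ incr

-- Stated for every predicate, so that one induction gives the multiplicities of the old letters and
-- of the new one; `s` is the number of boxes of the strip.
fillStrip-count : ∀ {n μ ν rows} (M : ℕ) → Strip μ ν → Rows n rows ν → Σ ℕ λ s → s + sum ν ≡ sum μ ×
  (∀ p → count p (concat (fillStrip M μ ν rows)) ≡ count p (concat rows) + s * bit (p M))
fillStrip-count M (last {a}) [] = a , refl , λ p →
  trans (cong (count p) (++-identityʳ (replicate a M))) (count-replicate p a M)
fillStrip-count M (_∷_ {a} {b} {c} {μ} {ν} (_ , b≤a) strip) (_∷_ {r} {xs = rs} _ rs∈)
  with s , s+ν≡μ , counts ← fillStrip-count M strip rs∈ = a ∸ b + s , size , counts′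
  where
  open ≡-Reasoning
  size : a ∸ b + s + (b + sum ν) ≡ a + sum (c ∷ μ)
  size = begin
    a ∸ b + s + (b + sum ν)   ≡⟨ lemma (a ∸ b) s b (sum ν) ⟩
    a ∸ b + b + (s + sum ν)   ≡⟨ cong₂ _+_ (m∸n+n≡m b≤a) s+ν≡μ ⟩
    a + sum (c ∷ μ)           ∎
    where
    lemma : ∀ x y z w → x + y + (z + w) ≡ x + z + (y + w)
    lemma = solve-∀
  counts′ : ∀ p → _ ≡ _
  counts′ p = begin
    count p ((r ++ replicate (a ∸ b) M) ++ concat (fillStrip M (c ∷ μ) ν rs))
      ≡⟨ count-++ p (r ++ replicate (a ∸ b) M) _ ⟩
    count p (r ++ replicate (a ∸ b) M) + count p (concat (fillStrip M (c ∷ μ) ν rs))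
      ≡⟨ cong₂ _+_ (trans (count-++ p r _) (cong (count p r +_) (count-replicate p (a ∸ b) M))) (counts p) ⟩
    count p r + (a ∸ b) * bit (p M) + (count p (concat rs) + s * bit (p M))
      ≡⟨ lemma (count p r) (a ∸ b) (bit (p M)) (count p (concat rs)) s ⟩
    count p r + count p (concat rs) + (a ∸ b + s) * bit (p M)
      ≡⟨ cong (_+ (a ∸ b + s) * bit (p M)) (count-++ p r (concat rs)) ⟨
    count p (r ++ concat rs) + (a ∸ b + s) * bit (p M) ∎
    where
    lemma : ∀ x y z w s → x + y * z + (w + s * z) ≡ x + w + (y + s) * z
    lemma = solve-∀

rows-entries : ∀ {hi rows ks} → Rows hi rows ks → All (λ e → 1 ≤ e × e ≤ hi) (concat rows)
rows-entries []                       = []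
rows-entries {ks = k ∷ _} (r∈ ∷ rs∈) = All.++⁺ (weakInc-bounds k r∈) (rows-entries rs∈)

rows-length : ∀ {hi rows ks} → Rows hi rows ks → length (concat rows) ≡ sum ks
rows-length []                                   = refl
rows-length {ks = k ∷ _} (_∷_ {r} {xs = rs} r∈ rs∈) =
  trans (length-++ r) (cong₂ _+_ (weakInc-length k r∈) (rows-length rs∈))

multiplicity : List (List ℕ) → ℕ → ℕ
multiplicity rows v = count (_≡ᵇ suc v) (concat rows)

applyUpTo-cong : {f g : ℕ → A} (n : ℕ) → (∀ v → v < n → f v ≡ g v) → applyUpTo f n ≡ applyUpTo g n
applyUpTo-cong zero    f≗g = refl
applyUpTo-cong (suc n) f≗g = cong₂ _∷_ (f≗g 0 z<s) (applyUpTo-cong n λ v v<n → f≗g (suc v) (s≤s v<n))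

≢⇒≡ᵇ-false : ∀ {a b} → a ≢ b → (a ≡ᵇ b) ≡ false
≢⇒≡ᵇ-false {a} {b} a≢b with a ≡ᵇ b in eq
... | false = refl
... | true  = contradiction (≡ᵇ⇒≡ a b (from T-≡ eq)) a≢b

≡ᵇ-refl : ∀ a → (a ≡ᵇ a) ≡ true
≡ᵇ-refl a = to T-≡ (≡⇒≡ᵇ a a refl)

-- The content of the tableau is any prescribed permutation of its shape: the last letter fills
-- the horizontal strip obtained by deleting the part that it has to appear with.
keyTableau : ∀ n μ α → length μ ≡ n → Linked _≥_ μ → α ↭ μ →
  Σ (List (List ℕ)) λ rows → Rows n rows μ × ColumnStrict rows × applyUpTo (multiplicity rows) n ≡ α
keyTableau zero    []      α _   _   α↭[] = [] , [] , [] , sym (↭-empty-inv α↭[])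
keyTableau (suc n) μ@(_ ∷ _) α len lnk α↭μ with List.initLast α
... | [] = contradiction (↭-length α↭μ) λ ()
... | α′ ∷ʳ′ x with ∈-∃++ (∈-resp-↭ α↭μ (∈-++⁺ʳ α′ (here refl)))
... | xs , ys , eq = extended (keyTableau n (xs ++ ys) α′ len′ (strip-linked strip) α′↭ν)
  where
  lnk′ : Linked _≥_ (xs ++ x ∷ ys)
  lnk′ = subst (Linked _≥_) eq lnk
  strip : Strip (xs ++ x ∷ ys) (xs ++ ys)
  strip = strip-remove xs lnk′
  len′ : length (xs ++ ys) ≡ n
  len′ = suc-injective (begin
    suc (length (xs ++ ys))       ≡⟨ cong suc (length-++ xs) ⟩
    suc (length xs + length ys)   ≡⟨ +-suc (length xs) (length ys) ⟨
    length xs + suc (length ys)   ≡⟨ length-++ xs ⟨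
    length (xs ++ x ∷ ys)         ≡⟨ cong length eq ⟨
    length μ                      ≡⟨ len ⟩
    suc n                         ∎)
    where open ≡-Reasoning
  α′↭ν : α′ ↭ xs ++ ys
  α′↭ν = subst (_↭ xs ++ ys) (++-identityʳ α′) (drop-mid α′ xs (subst (α′ ++ [ x ] ↭_) eq α↭μ))
  extended : (Σ (List (List ℕ)) λ rows →
               Rows n rows (xs ++ ys) × ColumnStrict rows × applyUpTo (multiplicity rows) n ≡ α′) →
             Σ (List (List ℕ)) λ rows →
               Rows (suc n) rows μ × ColumnStrict rows × applyUpTo (multiplicity rows) (suc n) ≡ α′ ++ [ x ]
  extended (rows , rows∈ , incr , content) =
    filled , subst (Rows (suc n) filled) (sym eq) (fillStrip-rows strip rows∈) , fillStrip-columns strip rows∈ incr ,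
    trans (sym (applyUpTo-∷ʳ (multiplicity filled) n))
      (cong₂ (λ β y → β ++ [ y ]) (trans (applyUpTo-cong n old) content) new)
    where
    filled = fillStrip (suc n) (xs ++ x ∷ ys) (xs ++ ys) rows
    counted = fillStrip-count (suc n) strip rows∈
    s = proj₁ counted
    -- The strip has as many boxes as the deleted part.
    s≡x : s ≡ x
    s≡x = +-cancelʳ-≡ (sum (xs ++ ys)) s x (begin
      s + sum (xs ++ ys)            ≡⟨ proj₁ (proj₂ counted) ⟩
      sum (xs ++ x ∷ ys)            ≡⟨ sum-++ xs (x ∷ ys) ⟩
      sum xs + (x + sum ys)         ≡⟨ lemma (sum xs) x (sum ys) ⟩
      x + (sum xs + sum ys)         ≡⟨ cong (x +_) (sum-++ xs ys) ⟨
      x + sum (xs ++ ys)            ∎)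
      where
      open ≡-Reasoning
      lemma : ∀ a b c → a + (b + c) ≡ b + (a + c)
      lemma = solve-∀
    counts : ∀ v → multiplicity filled v ≡ multiplicity rows v + s * bit (n ≡ᵇ v)
    counts v = proj₂ (proj₂ counted) (_≡ᵇ suc v)
    old : ∀ v → v < n → multiplicity filled v ≡ multiplicity rows v
    old v v<n rewrite counts v | ≢⇒≡ᵇ-false (<⇒≢ v<n ∘ sym) | *-zeroʳ s = +-identityʳ _
    -- The old tableau does not contain `suc n`, so all its occurrences come from the strip.
    new : multiplicity filled n ≡ x
    new rewrite counts n | ≡ᵇ-refl n | *-identityʳ s
      | count-none (_≡ᵇ suc n) (All.map (λ (_ , e≤n) → ≢⇒≡ᵇ-false (<⇒≢ (s≤s e≤n))) (rows-entries rows∈)) = s≡x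

-- Each entry at most `suc k` of the lower row stands below an entry at most `k`.
strictAbove-count : ∀ k t b → length b ≤ length t → T (strictAbove t b) →
  count (_≤ᵇ suc k) b ≤ count (_≤ᵇ k) t
strictAbove-count k t        []       _       _  = z≤n
strictAbove-count k []       (_ ∷ _)  ()
strictAbove-count k (t ∷ ts) (b ∷ bs) (s≤s len) st
  rewrite count-∷ (_≤ᵇ suc k) b bs | count-∷ (_≤ᵇ k) t ts =
  +-mono-≤ (bit-mono (λ b≤ → ≤⇒≤ᵇ (s≤s⁻¹ (≤-trans (<ᵇ⇒< t b t<b) (≤ᵇ⇒≤ b (suc k) b≤)))))
           (strictAbove-count k ts bs len (proj₂ (to T-∧ st)))
  where
  t<b : T (t <ᵇ b)
  t<b = proj₁ (to T-∧ st)
  bit-mono : ∀ {x y} → (T x → T y) → bit x ≤ bit y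
  bit-mono {false}         _   = z≤n
  bit-mono {true}  {true}  _   = s≤s z≤n
  bit-mono {true}  {false} imp = contradiction (imp _) λ ()

-- Letters k + 1 of a row lie below letters ≤ k of the row above, so the counts telescope.
multiplicity-bound : ∀ {hi r rows μ₀ μ} k → Rows hi (r ∷ rows) (μ₀ ∷ μ) → Linked _≥_ (μ₀ ∷ μ) →
  ColumnStrict (r ∷ rows) →
  count (_≤ᵇ suc k) (concat (r ∷ rows)) ≤ count (_≤ᵇ k) (concat (r ∷ rows)) + count (_≤ᵇ suc k) r
multiplicity-bound {r = r} k (_ ∷ []) _ _
  rewrite ++-identityʳ r = m≤n+m _ (count (_≤ᵇ k) r)
multiplicity-bound {r = r} {rows = r′ ∷ rows} {μ₀ = a} {μ = b ∷ _} k (r∈ ∷ rs∈@(r′∈ ∷ _)) (b≤a ∷ lnk) (r<r′ ∷ incr)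
  rewrite count-++ (_≤ᵇ suc k) r (concat (r′ ∷ rows)) | count-++ (_≤ᵇ k) r (concat (r′ ∷ rows)) = begin
  count (_≤ᵇ suc k) r + count (_≤ᵇ suc k) (concat (r′ ∷ rows))
    ≤⟨ +-monoʳ-≤ (count (_≤ᵇ suc k) r) (multiplicity-bound k rs∈ lnk incr) ⟩
  count (_≤ᵇ suc k) r + (count (_≤ᵇ k) (concat (r′ ∷ rows)) + count (_≤ᵇ suc k) r′)
    ≤⟨ +-monoʳ-≤ (count (_≤ᵇ suc k) r) (+-monoʳ-≤ (count (_≤ᵇ k) (concat (r′ ∷ rows)))
         (strictAbove-count k r r′ (≤-trans (≤-reflexive (weakInc-length b r′∈))
           (≤-trans b≤a (≤-reflexive (sym (weakInc-length a r∈))))) r<r′)) ⟩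
  count (_≤ᵇ suc k) r + (count (_≤ᵇ k) (concat (r′ ∷ rows)) + count (_≤ᵇ k) r)
    ≡⟨ lemma (count (_≤ᵇ suc k) r) (count (_≤ᵇ k) (concat (r′ ∷ rows))) (count (_≤ᵇ k) r) ⟩
  count (_≤ᵇ k) r + count (_≤ᵇ k) (concat (r′ ∷ rows)) + count (_≤ᵇ suc k) r ∎
  where
  open ≤-Reasoning
  lemma : ∀ x y z → x + (y + z) ≡ z + y + x
  lemma = solve-∀

-- Supports of Schur polynomials

isPartition-tail : ∀ {x} {ν : Vec ℕ m} → IsPartition (x ∷ ν) → IsPartition ν
isPartition-tail part i j i≤j = part (suc i) (suc j) (s≤s i≤j)

isPartition⇒linked : (ν : Vec ℕ m) → IsPartition ν → Linked _≥_ (toList ν)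
isPartition⇒linked []          _    = []
isPartition⇒linked (_ ∷ [])    _    = [-]
isPartition⇒linked (_ ∷ ν@(_ ∷ _)) part = part zero (suc zero) z≤n ∷ isPartition⇒linked ν (isPartition-tail part)

sum-toList : (ν : Vec ℕ m) → sum (toList ν) ≡ ∣ ν ∣ᵥ
sum-toList []      = refl
sum-toList (x ∷ ν) = cong (x +_) (sum-toList ν)

foldr-∧⁺ : (f : A → Bool) (xs : List A) → (∀ x → T (f x)) → T (List.foldr _∧_ true (List.map f xs))
foldr-∧⁺ f []       _  = _
foldr-∧⁺ f (x ∷ xs) Tf = from T-∧ (Tf x , foldr-∧⁺ f xs Tf)

foldr-∧⁻ : (f : A → Bool) {xs : List A} {x : A} → T (List.foldr _∧_ true (List.map f xs)) → x ∈ xs → T (f x)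
foldr-∧⁻ f all (here refl)  = proj₁ (to T-∧ all)
foldr-∧⁻ f all (there x∈xs) = foldr-∧⁻ f (proj₂ (to T-∧ all)) x∈xs

columnsOK⁺ : ∀ k {rows} → ColumnStrict rows → T (columnsOK (toList (Vec.replicate k 0)) rows)
columnsOK⁺ (suc (suc k)) (s ∷ incr)   = from T-∧ (s , columnsOK⁺ (suc k) incr)
columnsOK⁺ zero          incr         = _
columnsOK⁺ (suc zero)    incr         = _
columnsOK⁺ (suc (suc k)) []             = _
columnsOK⁺ (suc (suc k)) [-]            = _

-- The length condition matters: `columnsOK` accepts all remaining rows once the list of offsets
-- runs out.
columnsOK⁻ : ∀ {hi rows ks} k → length ks ≡ k → Rows hi rows ks →
  T (columnsOK (toList (Vec.replicate k 0)) rows) → ColumnStrict rows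
columnsOK⁻ _             _   []           _  = []
columnsOK⁻ _             _   (_ ∷ [])     _  = [-]
columnsOK⁻ (suc (suc k)) len (_ ∷ rs∈@(_ ∷ _)) ok =
  let s , ok′ = to T-∧ ok in s ∷ columnsOK⁻ (suc k) (suc-injective len) rs∈ ok′

lookup-applyUpTo : ∀ (f : ℕ → ℕ) (α : Vec ℕ m) → applyUpTo f m ≡ toList α → ∀ j → lookup α j ≡ f (toℕ j)
lookup-applyUpTo f (x ∷ α) eq   zero    = sym (∷-injectiveˡ eq)
lookup-applyUpTo f (x ∷ α) eq   (suc j) = lookup-applyUpTo (f ∘ suc) α (∷-injectiveʳ eq) j

-- All explicit points of supports constructed below come from here.
suppSchur-permutation : (μ : Vec ℕ m) → IsPartition μ → (α : Vec ℕ m) → toList α ↭ toList μ → SuppSchur μ α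
suppSchur-permutation {m} μ part α α↭μ
  with rows , rows∈ , incr , content ←
    keyTableau m (toList μ) (toList α) (length-toList μ) (isPartition⇒linked μ part) α↭μ =
  count-∈ _ (subst (λ ks → rows ∈ choices ks) (sym (toList-map (weakInc 1 m) μ)) (∈-choices⁺ (weakInc 1 m) rows∈))
    (from T-∧ (columnsOK⁺ m incr ,
      foldr-∧⁺ _ (allFin m) λ j → ≡⇒≡ᵇ _ _ (sym (lookup-applyUpTo (multiplicity rows) α content j))))

suppSchur-tableau : (μ α : Vec ℕ m) → SuppSchur μ α → Σ (List (List ℕ)) λ rows →
  Rows m rows (toList μ) × ColumnStrict rows × (∀ j → lookup α j ≡ multiplicity rows (toℕ j))
suppSchur-tableau {m} μ α supp
  with rows , rows∈ , ok ← count≢0 _ _ supp =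
  let rows∈′ = ∈-choices⁻ (weakInc 1 m) (toList μ) (subst (λ ks → rows ∈ choices ks) (toList-map (weakInc 1 m) μ) rows∈)
      columns , content = to T-∧ ok
  in rows , rows∈′ , columnsOK⁻ m (length-toList μ) rows∈′ columns ,
     λ j → sym (≡ᵇ⇒≡ _ _ (foldr-∧⁻ _ content (∈-allFin j)))

-- The threshold `k` is general so that the induction can add one letter at a time; the case needed
-- later is `k` = 0.
count-≤-sum : ∀ k es (α : Vec ℕ m) → (∀ j → lookup α j ≡ count (_≡ᵇ suc (k + toℕ j)) es) →
  count (_≤ᵇ k) es + ∣ α ∣ᵥ ≡ count (_≤ᵇ k + m) es
count-≤-sum k es []      _ rewrite +-identityʳ k = +-identityʳ _
count-≤-sum {suc m} k es (x ∷ α) content = begin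
  count (_≤ᵇ k) es + (x + ∣ α ∣ᵥ)
    ≡⟨ cong (λ y → count (_≤ᵇ k) es + (y + ∣ α ∣ᵥ)) (trans (content zero) (cong (λ i → count (_≡ᵇ suc i) es) (+-identityʳ k))) ⟩
  count (_≤ᵇ k) es + (count (_≡ᵇ suc k) es + ∣ α ∣ᵥ)
    ≡⟨ +-assoc (count (_≤ᵇ k) es) _ _ ⟨
  count (_≤ᵇ k) es + count (_≡ᵇ suc k) es + ∣ α ∣ᵥ
    ≡⟨ cong (_+ ∣ α ∣ᵥ) (count-≤-suc k es) ⟨
  count (_≤ᵇ suc k) es + ∣ α ∣ᵥ
    ≡⟨ count-≤-sum (suc k) es α (λ j → trans (content (suc j)) (cong (λ i → count (_≡ᵇ suc i) es) (+-suc k (toℕ j)))) ⟩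
  count (_≤ᵇ suc k + m) es
    ≡⟨ cong (λ i → count (_≤ᵇ i) es) (+-suc k m) ⟨
  count (_≤ᵇ k + suc m) es ∎
  where open ≡-Reasoning

-- Every entry of a tableau is one of 1, ..., `m`, so the content adds up to the number of boxes.
suppSchur-sum : (μ α : Vec ℕ m) → SuppSchur μ α → ∣ α ∣ᵥ ≡ ∣ μ ∣ᵥ
suppSchur-sum {m} μ α supp with rows , rows∈ , _ , content ← suppSchur-tableau μ α supp = begin
  ∣ α ∣ᵥ
    ≡⟨ cong (_+ ∣ α ∣ᵥ) (count-none (_≤ᵇ 0) (All.map (λ { {suc _} _ → refl }) (rows-entries rows∈))) ⟨
  count (_≤ᵇ 0) (concat rows) + ∣ α ∣ᵥ
    ≡⟨ count-≤-sum 0 (concat rows) α content ⟩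
  count (_≤ᵇ m) (concat rows)
    ≡⟨ count-all (_≤ᵇ m) (All.map (λ (_ , e≤m) → to T-≡ (≤⇒≤ᵇ e≤m)) (rows-entries rows∈)) ⟩
  length (concat rows)
    ≡⟨ rows-length rows∈ ⟩
  sum (toList μ)
    ≡⟨ sum-toList μ ⟩
  ∣ μ ∣ᵥ ∎
  where open ≡-Reasoning

-- The multiplicity of a letter is the difference of two consecutive counts, which
-- `multiplicity-bound` bounds by the number of small entries in the first row, hence by its length.
suppSchur-bound : ∀ {x} (μ : Vec ℕ m) (α : Vec ℕ (suc m)) → IsPartition (x ∷ μ) → SuppSchur (x ∷ μ) α →
  ∀ j → lookup α j ≤ x
suppSchur-bound {x = x} μ α part supp j with suppSchur-tableau (x ∷ μ) α supp
... | r ∷ rows , rows∈@(r∈ ∷ _) , incr , content = begin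
  lookup α j                             ≡⟨ content j ⟩
  count (_≡ᵇ suc k) (concat (r ∷ rows))  ≤⟨ +-cancelˡ-≤ (count (_≤ᵇ k) (concat (r ∷ rows))) _ _
    (≤-trans (≤-reflexive (sym (count-≤-suc k (concat (r ∷ rows)))))
             (multiplicity-bound k rows∈ (isPartition⇒linked (x ∷ μ) part) incr)) ⟩
  count (_≤ᵇ suc k) r                    ≤⟨ count≤length (_≤ᵇ suc k) r ⟩
  length r                               ≡⟨ weakInc-length x r∈ ⟩
  x                                      ∎
  where
  open ≤-Reasoning
  k = toℕ j

-- Partitions occurring in G

-- These are the admissible partitions of the overview; the function `admissible` is about rows that
-- can take another box.
record Candidate (h : ℕ) (lam mu : Vec ℕ m) : Set where
  field
    partition : IsPartition mu
    lower     : ∀ i → lookup lam i ≤ lookup mu i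
    upper     : ∀ i → lookup mu i ≤ lookup lam i + h * toℕ i

open Candidate

interval : ℕ → ℕ → List ℕ
interval a zero    = []
interval a (suc n) = a ∷ interval (suc a) n

interval-∈-strictInc : ∀ {lo hi} a n → lo ≤ a → a + n ≤ suc hi → interval a n ∈ strictInc lo hi n
interval-∈-strictInc a zero    _    _  = here refl
interval-∈-strictInc a (suc n) lo≤a a+n≤ = ∈-concatMap-map⁺ _∷_ _
  (∈-range⁺ lo≤a (s≤s⁻¹ (≤-trans (m<m+n a z<s) a+n≤)))
  (interval-∈-strictInc (suc a) n ≤-refl (≤-trans (≤-reflexive (sym (+-suc a n))) a+n≤))

-- Both rows consist of consecutive numbers, so it suffices to compare the first pair; after the
-- drop the lower row starts at `b + d`.
strictAbove-interval : ∀ a n b k d → a < b + d → T (strictAbove (interval a n) (drop d (interval b k)))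
strictAbove-interval a zero    b k       d       _   = _
strictAbove-interval a (suc n) b zero    zero    _   = _
strictAbove-interval a (suc n) b zero    (suc d) _   = _
strictAbove-interval a (suc n) b (suc k) zero    a<b =
  let a<b′ = subst (a <_) (+-identityʳ b) a<b
  in from T-∧ (<⇒<ᵇ a<b′ , strictAbove-interval (suc a) n (suc b) k 0 (s≤s a<b))
strictAbove-interval a (suc n) b (suc k) (suc d) a<b =
  strictAbove-interval a (suc n) (suc b) k d (subst (a <_) (+-suc b d) a<b)

-- For `n` ≤ `c` these are the `n` largest numbers of 1, ..., `c`.
topRow : ℕ → ℕ → List ℕ
topRow c n = interval (suc (c ∸ n)) n

topRows-∈-choices : (c n : Fin m → ℕ) → (∀ i → n i ≤ c i) →
  toList (tabulate (λ i → topRow (c i) (n i))) ∈ choices (toList (tabulate (λ i → strictInc 1 (c i) (n i))))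
topRows-∈-choices {zero}  c n n≤c = here refl
topRows-∈-choices {suc m} c n n≤c = ∈-concatMap-map⁺ _∷_ _
  (interval-∈-strictInc (suc (c zero ∸ n zero)) (n zero) (s≤s z≤n) (s≤s (≤-reflexive (m∸n+n≡m (n≤c zero)))))
  (topRows-∈-choices (c ∘ suc) (n ∘ suc) (n≤c ∘ suc))

-- In column x, row i contains c_i - μ_i + x. Down a column c_i increases strictly while μ_i
-- decreases weakly.
topRows-columnsOK : (lam mu : Vec ℕ m) (c : Fin m → ℕ) → IsPartition lam → IsPartition mu →
  (∀ i → lookup lam i ≤ lookup mu i) → (∀ i → lookup mu i ∸ lookup lam i ≤ c i) →
  (∀ i j → i Fin.< j → c i < c j) →
  T (columnsOK (toList lam) (toList (tabulate (λ i → topRow (c i) (lookup mu i ∸ lookup lam i)))))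
topRows-columnsOK []      _ _ _ _ _ _ _ = _
topRows-columnsOK (_ ∷ []) _ _ _ _ _ _ _ = _
topRows-columnsOK (l₀ ∷ l₁ ∷ lam) (u₀ ∷ u₁ ∷ mu) c partλ partμ λ≤μ fits increasing = from T-∧
  ( strictAbove-interval (suc (c zero ∸ (u₀ ∸ l₀))) (u₀ ∸ l₀) (suc (c (suc zero) ∸ (u₁ ∸ l₁))) (u₁ ∸ l₁) (l₀ ∸ l₁) (s≤s step)
  , topRows-columnsOK (l₁ ∷ lam) (u₁ ∷ mu) (c ∘ suc) (isPartition-tail partλ) (isPartition-tail partμ)
      (λ≤μ ∘ suc) (fits ∘ suc) (λ i j i<j → increasing (suc i) (suc j) (s≤s i<j)))
  where
  c₀ = c zero
  c₁ = c (suc zero)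
  widths : u₁ ∸ l₁ ≤ l₀ ∸ l₁ + (u₀ ∸ l₀)
  widths = m≤n+o⇒m∸n≤o u₁ l₁ (begin
    u₁                             ≤⟨ partμ zero (suc zero) z≤n ⟩
    u₀                             ≡⟨ m+[n∸m]≡n (λ≤μ zero) ⟨
    l₀ + (u₀ ∸ l₀)                 ≡⟨ cong (_+ (u₀ ∸ l₀)) (m+[n∸m]≡n (partλ zero (suc zero) z≤n)) ⟨
    l₁ + (l₀ ∸ l₁) + (u₀ ∸ l₀)     ≡⟨ +-assoc l₁ _ _ ⟩
    l₁ + (l₀ ∸ l₁ + (u₀ ∸ l₀))     ∎)
    where open ≤-Reasoning
  step : c₀ ∸ (u₀ ∸ l₀) < c₁ ∸ (u₁ ∸ l₁) + (l₀ ∸ l₁)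
  -- Adding the width of the upper row to both sides removes the truncated subtraction on the left.
  step = +-cancelʳ-< (u₀ ∸ l₀) _ _ (begin-strict
    c₀ ∸ (u₀ ∸ l₀) + (u₀ ∸ l₀)                  ≡⟨ m∸n+n≡m (fits zero) ⟩
    c₀                                          <⟨ increasing zero (suc zero) (s≤s z≤n) ⟩
    c₁                                          ≡⟨ m∸n+n≡m (fits (suc zero)) ⟨
    c₁ ∸ (u₁ ∸ l₁) + (u₁ ∸ l₁)                  ≤⟨ +-monoʳ-≤ (c₁ ∸ (u₁ ∸ l₁)) widths ⟩
    c₁ ∸ (u₁ ∸ l₁) + (l₀ ∸ l₁ + (u₀ ∸ l₀))      ≡⟨ +-assoc (c₁ ∸ (u₁ ∸ l₁)) _ _ ⟨
    c₁ ∸ (u₁ ∸ l₁) + (l₀ ∸ l₁) + (u₀ ∸ l₀)      ∎)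
    where open ≤-Reasoning

-- Filling every row with the largest entries it may contain is strict along columns.
bcoef≢0 : ∀ h (lam mu : Vec ℕ m) → 1 ≤ h → IsPartition lam → Candidate h lam mu → bcoef h lam mu ≢ 0
bcoef≢0 h@(suc _) lam mu _ partλ cand = count-∈ _
  (topRows-∈-choices (λ i → h * toℕ i) (λ i → lookup mu i ∸ lookup lam i) fits)
  (topRows-columnsOK lam mu (λ i → h * toℕ i) partλ (partition cand) (lower cand) fits
    (λ i j i<j → *-monoʳ-< h i<j))
  where
  fits : ∀ i → lookup mu i ∸ lookup lam i ≤ h * toℕ i
  fits i = m≤n+o⇒m∸n≤o (lookup mu i) (lookup lam i) (upper cand i)

∈-boxVecs : (ls us xs : Vec ℕ m) → (∀ i → lookup ls i ≤ lookup xs i) → (∀ i → lookup xs i ≤ lookup us i) →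
  xs ∈ boxVecs ls us
∈-boxVecs []       []       []       _    _    = here refl
∈-boxVecs (l ∷ ls) (u ∷ us) (x ∷ xs) ls≤ ≤us = ∈-concatMap-map⁺ _∷_ _
  (∈-range⁺ (ls≤ zero) (≤us zero)) (∈-boxVecs ls us xs (ls≤ ∘ suc) (≤us ∘ suc))

decreasingᵇ-linked : ∀ {xs} → Linked _≥_ xs → T (decreasingᵇ xs)
decreasingᵇ-linked []          = _
decreasingᵇ-linked [-]         = _
decreasingᵇ-linked (y≤x ∷ lnk) = from T-∧ (≤⇒≤ᵇ y≤x , decreasingᵇ-linked lnk)

∈-candidates : ∀ h (lam mu : Vec ℕ m) → Candidate h lam mu → mu ∈ candidates h lam
∈-candidates h lam mu cand = ∈-filter⁺ (λ ν → T? (decreasingᵇ (toList ν)))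
  (∈-boxVecs lam _ mu (lower cand) λ i → ≤-trans (upper cand i)
    (≤-reflexive (sym (lookup∘tabulate (λ i → lookup lam i + h * toℕ i) i))))
  (decreasingᵇ-linked (isPartition⇒linked mu (partition cand)))

sign≢0 : ∀ n → sign n ≢ 0ℤ
sign≢0 zero          = λ ()
sign≢0 (suc zero)    = λ ()
sign≢0 (suc (suc n)) = sign≢0 n

-- Turns a sum of terms with a common sign into that sign times a sum of natural numbers.
foldr-factor : (s : ℤ) (f : A → ℤ) (g : A → ℕ) → (∀ x → f x ≡ s *ᶻ pos (g x)) → ∀ xs →
  List.foldr _+ᶻ_ 0ℤ (List.map f xs) ≡ s *ᶻ pos (sum (List.map g xs))
foldr-factor s f g f≗ []       = sym (ℤₚ.*-zeroʳ s)
foldr-factor s f g f≗ (x ∷ xs) = begin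
  f x +ᶻ List.foldr _+ᶻ_ 0ℤ (List.map f xs)        ≡⟨ cong₂ _+ᶻ_ (f≗ x) (foldr-factor s f g f≗ xs) ⟩
  s *ᶻ pos (g x) +ᶻ s *ᶻ pos (sum (List.map g xs)) ≡⟨ ℤₚ.*-distribˡ-+ s (pos (g x)) _ ⟨
  s *ᶻ (pos (g x) +ᶻ pos (sum (List.map g xs)))    ≡⟨ cong (s *ᶻ_) (ℤₚ.pos-+ (g x) _) ⟨
  s *ᶻ pos (g x + sum (List.map g xs))             ∎
  where open ≡-Reasoning

sum-map≢0 : (g : A → ℕ) {x : A} {xs : List A} → x ∈ xs → g x ≢ 0 → sum (List.map g xs) ≢ 0
sum-map≢0 g {x} (here refl) gx≢0 sum≡0 = gx≢0 (m+n≡0⇒m≡0 (g x) sum≡0)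
sum-map≢0 g {xs = y ∷ _} (there x∈) gx≢0 sum≡0 = sum-map≢0 g x∈ gx≢0 (m+n≡0⇒n≡0 (g y) sum≡0)

-- The sign only depends on the degree, so no cancellation takes place.
suppSchur⇒suppG : ∀ h (lam mu : Vec ℕ m) → 1 ≤ h → IsPartition lam → Candidate h lam mu →
  ∀ α → SuppSchur mu α → SuppG h lam α
suppSchur⇒suppG h lam mu 1≤h partλ cand α supp coeff≡0 =
  nonzero (ℤₚ.i*j≡0⇒i≡0∨j≡0 s
    (trans (sym (foldr-factor s _ weight term (candidates h lam))) coeff≡0))
  where
  s = sign (∣ α ∣ᵥ ∸ ∣ lam ∣ᵥ)
  weight : Vec ℕ _ → ℕ
  weight ν = bcoef h lam ν * kostka ν α
  term : ∀ ν → sign (∣ ν ∣ᵥ ∸ ∣ lam ∣ᵥ) *ᶻ pos (bcoef h lam ν) *ᶻ pos (kostka ν α) ≡ s *ᶻ pos (weight ν)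
  -- If the Kostka number is 0, both sides vanish. Otherwise ν has the degree of `α`, so its sign is
  -- `s`.
  term ν with kostka ν α in eq
  ... | zero  = trans (ℤₚ.*-zeroʳ (sign (∣ ν ∣ᵥ ∸ ∣ lam ∣ᵥ) *ᶻ pos (bcoef h lam ν))) (sym (trans (cong (λ k → s *ᶻ pos k) (*-zeroʳ (bcoef h lam ν))) (ℤₚ.*-zeroʳ s)))
  ... | suc k = begin
    sign (∣ ν ∣ᵥ ∸ ∣ lam ∣ᵥ) *ᶻ pos (bcoef h lam ν) *ᶻ pos (suc k)
      ≡⟨ cong (λ e → sign (e ∸ ∣ lam ∣ᵥ) *ᶻ pos (bcoef h lam ν) *ᶻ pos (suc k))
           (suppSchur-sum ν α λ ≡0 → contradiction (trans (sym eq) ≡0) λ ()) ⟨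
    s *ᶻ pos (bcoef h lam ν) *ᶻ pos (suc k)
      ≡⟨ ℤₚ.*-assoc s _ _ ⟩
    s *ᶻ (pos (bcoef h lam ν) *ᶻ pos (suc k))
      ≡⟨ cong (s *ᶻ_) (ℤₚ.pos-* (bcoef h lam ν) (suc k)) ⟨
    s *ᶻ pos (bcoef h lam ν * suc k) ∎
    where open ≡-Reasoning
  nonzero : ¬ (s ≡ 0ℤ ⊎ pos (sum (List.map weight (candidates h lam))) ≡ 0ℤ)
  nonzero (inj₁ s≡0)   = sign≢0 (∣ α ∣ᵥ ∸ ∣ lam ∣ᵥ) s≡0
  nonzero (inj₂ sum≡0) = sum-map≢0 weight (∈-candidates h lam mu cand)
    (λ w≡0 → product≢0 (m*n≡0⇒m≡0∨n≡0 (bcoef h lam mu) w≡0)) (ℤₚ.+-injective sum≡0)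
    where
    product≢0 : ¬ (bcoef h lam mu ≡ 0 ⊎ kostka mu α ≡ 0)
    product≢0 (inj₁ b≡0) = bcoef≢0 h lam mu 1≤h partλ cand b≡0
    product≢0 (inj₂ k≡0) = supp k≡0

candidate-refl : ∀ h (lam : Vec ℕ m) → IsPartition lam → Candidate h lam lam
candidate-refl h lam part = record
  { partition = part ; lower = λ _ → ≤-refl ; upper = λ i → m≤m+n (lookup lam i) (h * toℕ i) }

candidate-suc : ∀ {h} {lam mu : Vec ℕ m} → Candidate h lam mu → ∀ r →
  (∀ i → i Fin.< r → lookup mu r < lookup mu i) → lookup mu r < lookup lam r + h * toℕ r →
  Candidate h lam (updateAt mu r suc)
candidate-suc {h = h} {lam} {mu} cand r room capacity = record
  { partition = part ; lower = low ; upper = up }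
  where
  at-r = lookup∘updateAt r {suc} mu
  off : ∀ i → i ≢ r → lookup (updateAt mu r suc) i ≡ lookup mu i
  off i i≢r = lookup∘updateAt′ i r i≢r mu
  part : IsPartition (updateAt mu r suc)
  part i j i≤j with i Finₚ.≟ r | j Finₚ.≟ r
  ... | yes refl | yes refl = ≤-refl
  ... | yes refl | no j≢r rewrite at-r | off j j≢r = m≤n⇒m≤1+n (partition cand i j i≤j)
  ... | no i≢r | yes refl rewrite at-r | off i i≢r = room i (Finₚ.≤∧≢⇒< i≤j i≢r)
  ... | no i≢r | no j≢r rewrite off i i≢r | off j j≢r = partition cand i j i≤j
  low : ∀ i → lookup lam i ≤ lookup (updateAt mu r suc) i
  low i with i Finₚ.≟ r
  ... | yes refl rewrite at-r = m≤n⇒m≤1+n (lower cand i)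
  ... | no i≢r rewrite off i i≢r = lower cand i
  up : ∀ i → lookup (updateAt mu r suc) i ≤ lookup lam i + h * toℕ i
  up i with i Finₚ.≟ r
  ... | yes refl rewrite at-r = capacity
  ... | no i≢r rewrite off i i≢r = upper cand i

candidate-pred : ∀ {h} {lam mu : Vec ℕ m} → Candidate h lam mu → ∀ r →
  (∀ j → r Fin.< j → lookup mu j < lookup mu r) → lookup lam r < lookup mu r →
  Candidate h lam (updateAt mu r pred)
candidate-pred {h = h} {lam} {mu} cand r corner excess = record
  { partition = part ; lower = low ; upper = up }
  where
  at-r = lookup∘updateAt r {pred} mu
  off : ∀ i → i ≢ r → lookup (updateAt mu r pred) i ≡ lookup mu i
  off i i≢r = lookup∘updateAt′ i r i≢r mu
  part : IsPartition (updateAt mu r pred)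
  part i j i≤j with i Finₚ.≟ r | j Finₚ.≟ r
  ... | yes refl | yes refl = ≤-refl
  ... | yes refl | no j≢r rewrite at-r | off j j≢r = pred-mono-≤ (corner j (Finₚ.≤∧≢⇒< i≤j (j≢r ∘ sym)))
  ... | no i≢r | yes refl rewrite at-r | off i i≢r = ≤-trans pred[n]≤n (partition cand i j i≤j)
  ... | no i≢r | no j≢r rewrite off i i≢r | off j j≢r = partition cand i j i≤j
  low : ∀ i → lookup lam i ≤ lookup (updateAt mu r pred) i
  low i with i Finₚ.≟ r
  ... | yes refl rewrite at-r = pred-mono-≤ excess
  ... | no i≢r rewrite off i i≢r = lower cand i
  up : ∀ i → lookup (updateAt mu r pred) i ≤ lookup lam i + h * toℕ i
  up i with i Finₚ.≟ r
  ... | yes refl rewrite at-r = ≤-trans pred[n]≤n (upper cand i)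
  ... | no i≢r rewrite off i i≢r = upper cand i

firstTrue-sound : (p : Fin m → Bool) (is : List (Fin m)) {r : Fin m} → firstTrue p is ≡ just r → T (p r)
firstTrue-sound p (i ∷ is) eq with p i in pi
firstTrue-sound p (i ∷ is) refl | true  = from T-≡ pi
firstTrue-sound p (i ∷ is) eq   | false = firstTrue-sound p is eq

-- `addOK` looks only at the row directly above; the rows further up are at least as long.
addOK-room : (ν : Vec ℕ m) → IsPartition ν → ∀ r → T (addOK ν r) →
  ∀ i → i Fin.< r → lookup ν r < lookup ν i
addOK-room ν part (suc r) ok i i<r = <-≤-trans (<ᵇ⇒< _ _ ok)
  (part i (inject₁ r) (subst (toℕ i ≤_) (sym (Finₚ.toℕ-inject₁ r)) (s≤s⁻¹ i<r)))

domStep-candidate : ∀ {h} {lam ν : Vec ℕ m} → Candidate h lam ν → Candidate h lam (domStep h lam ν)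
domStep-candidate {m} {h} {lam} {ν} cand with firstTrue (admissible h lam ν) (allFin m) in eq
... | nothing = cand
... | just r  =
  let below , ok = to T-∧ (firstTrue-sound (admissible h lam ν) (allFin m) eq)
  in candidate-suc cand r (addOK-room ν (partition cand) r ok)
       (subst (_< lookup lam r + h * toℕ r) (m+[n∸m]≡n (lower cand r)) (+-monoʳ-< (lookup lam r) (<ᵇ⇒< _ _ below)))

-- The dominating sequence enters the proof here: each of its steps respects the row bounds and the
-- partition shape.
domSeq-candidate : ∀ h (lam : Vec ℕ m) → IsPartition lam → ∀ k → Candidate h lam (domSeq h lam k)
domSeq-candidate h lam part zero    = candidate-refl h lam part
domSeq-candidate h lam part (suc k) = domStep-candidate (domSeq-candidate h lam part k)

-- Partial sums

take-updateAt : ∀ (ν : Vec ℕ m) r f s → s ≤ toℕ r → take s (toList (updateAt ν r f)) ≡ take s (toList ν)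
take-updateAt ν       r       f zero    _         = refl
take-updateAt (x ∷ ν) (suc r) f (suc s) (s≤s s≤r) = cong (x ∷_) (take-updateAt ν r f s s≤r)

drop-updateAt : ∀ (ν : Vec ℕ m) r f s → toℕ r < s → drop s (toList (updateAt ν r f)) ≡ drop s (toList ν)
drop-updateAt (x ∷ ν) zero    f (suc s) _         = refl
drop-updateAt (x ∷ ν) (suc r) f (suc s) (s≤s r<s) = drop-updateAt ν r f s r<s

take-updateAt-suc : ∀ (ν : Vec ℕ m) r s → sum (take s (toList ν)) ≤ sum (take s (toList (updateAt ν r suc)))
take-updateAt-suc ν       r       zero    = z≤n
take-updateAt-suc (x ∷ ν) zero    (suc s) = n≤1+n _
take-updateAt-suc (x ∷ ν) (suc r) (suc s) = +-monoʳ-≤ x (take-updateAt-suc ν r s)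

drop-updateAt-pred : ∀ (ν : Vec ℕ m) r s → sum (drop s (toList (updateAt ν r pred))) ≤ sum (drop s (toList ν))
drop-updateAt-pred (x ∷ ν) zero    zero    = +-monoˡ-≤ (sum (toList ν)) pred[n]≤n
drop-updateAt-pred (x ∷ ν) (suc r) zero    = +-monoʳ-≤ x (drop-updateAt-pred ν r zero)
drop-updateAt-pred (x ∷ ν) zero    (suc s) = ≤-refl
drop-updateAt-pred (x ∷ ν) (suc r) (suc s) = drop-updateAt-pred ν r s

sum-updateAt-suc : ∀ (ν : Vec ℕ m) r → ∣ updateAt ν r suc ∣ᵥ ≡ suc ∣ ν ∣ᵥ
sum-updateAt-suc (x ∷ ν) zero    = refl
sum-updateAt-suc (x ∷ ν) (suc r) = trans (cong (x +_) (sum-updateAt-suc ν r)) (+-suc x ∣ ν ∣ᵥ)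

sum-updateAt-pred : ∀ (ν : Vec ℕ m) r → 0 < lookup ν r → suc ∣ updateAt ν r pred ∣ᵥ ≡ ∣ ν ∣ᵥ
sum-updateAt-pred (suc x ∷ ν) zero    _ = refl
sum-updateAt-pred (x ∷ ν)     (suc r) p = trans (sym (+-suc x _)) (cong (x +_) (sum-updateAt-pred ν r p))

sum-take-drop : ∀ s (ν : Vec ℕ m) → sum (take s (toList ν)) + sum (drop s (toList ν)) ≡ ∣ ν ∣ᵥ
sum-take-drop s ν = begin
  sum (take s (toList ν)) + sum (drop s (toList ν)) ≡⟨ sum-++ (take s (toList ν)) _ ⟨
  sum (take s (toList ν) ++ drop s (toList ν))      ≡⟨ cong sum (take++drop≡id s (toList ν)) ⟩
  sum (toList ν)                                    ≡⟨ sum-toList ν ⟩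
  ∣ ν ∣ᵥ                                            ∎
  where open ≡-Reasoning

sumOver-∁ : (S : Subset m) (x : Vec ℕ m) → sumOver S x + sumOver (∁ S) x ≡ ∣ x ∣ᵥ
sumOver-∁ []          []      = refl
sumOver-∁ (true ∷ S)  (x ∷ v) = trans (+-assoc x _ _) (cong (x +_) (sumOver-∁ S v))
sumOver-∁ (false ∷ S) (x ∷ v) = trans (lemma (sumOver S v) x _) (cong (x +_) (sumOver-∁ S v))
  where
  lemma : ∀ a b c → a + (b + c) ≡ b + (a + c)
  lemma = solve-∀

arrange : (I : Subset m) (as bs : List ℕ) → length as ≡ ∣ I ∣ → length bs ≡ ∣ ∁ I ∣ →
  Σ (Vec ℕ m) λ α → toList α ↭ as ++ bs × sumOver I α ≡ sum as × sumOver (∁ I) α ≡ sum bs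
arrange []          []       []       _  _  = [] , ↭-refl , refl , refl
arrange (true ∷ I)  (a ∷ as) bs       p  q  =
  let α , perm , inI , offI = arrange I as bs (suc-injective p) q
  in a ∷ α , prep a perm , cong (a +_) inI , offI
arrange (false ∷ I) as       (b ∷ bs) p  q  =
  let α , perm , inI , offI = arrange I as bs p (suc-injective q)
  in b ∷ α , ↭-trans (prep b perm) (↭-sym (shift b as bs)) , inI , cong (b +_) offI

-- When `ν` is a partition, this puts its largest parts on `I`, so the sum over `I` is the largest
-- and the sum off `I` the smallest among all permutations.
arrangeOnto : (I : Subset m) (ν : Vec ℕ m) → Σ (Vec ℕ m) λ α → toList α ↭ toList ν ×
  sumOver I α ≡ sum (take ∣ I ∣ (toList ν)) × sumOver (∁ I) α ≡ sum (drop ∣ I ∣ (toList ν))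
arrangeOnto {m} I ν =
  let α , perm , sums = arrange I (take ∣ I ∣ (toList ν)) (drop ∣ I ∣ (toList ν))
        (trans (length-take ∣ I ∣ (toList ν)) (trans (cong (∣ I ∣ ⊓_) (length-toList ν)) (m≤n⇒m⊓n≡m (∣p∣≤n I))))
        (trans (length-drop ∣ I ∣ (toList ν)) (trans (cong (_∸ ∣ I ∣) (length-toList ν)) (sym (∣∁p∣≡n∸∣p∣ I))))
  in α , ↭-trans perm (↭-reflexive (take++drop≡id ∣ I ∣ (toList ν))) , sums

-- Coordinate sums as functionals

indicator : Subset m → Fin m → ℤ
indicator S j = pos (bit (lookup S j))

dot-indicator : (S : Subset m) (x : Vec ℕ m) → dot (indicator S) x ≡ pos (sumOver S x)
dot-indicator []          []      = refl
dot-indicator (true ∷ S)  (x ∷ v) = trans (cong₂ _+ᶻ_ (ℤₚ.*-identityˡ (pos x)) (dot-indicator S v)) (sym (ℤₚ.pos-+ x (sumOver S v)))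
dot-indicator (false ∷ S) (x ∷ v) = trans (cong (_+ᶻ dot (indicator S) v) (ℤₚ.*-zeroˡ (pos x)))
                                          (trans (ℤₚ.+-identityˡ _) (dot-indicator S v))

sumOver-⊤ : (x : Vec ℕ m) → sumOver ⊤ x ≡ ∣ x ∣ᵥ
sumOver-⊤ []      = refl
sumOver-⊤ (x ∷ v) = cong (x +_) (sumOver-⊤ v)

sumOver-⊥ : (x : Vec ℕ m) → sumOver ⊥ x ≡ 0
sumOver-⊥ []      = refl
sumOver-⊥ (x ∷ v) = sumOver-⊥ v

sumOver-⁅⁆ : ∀ i (x : Vec ℕ m) → sumOver ⁅ i ⁆ x ≡ lookup x i
sumOver-⁅⁆ zero    (x ∷ v) = trans (cong (x +_) (sumOver-⊥ v)) (+-identityʳ x)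
sumOver-⁅⁆ (suc i) (x ∷ v) = sumOver-⁅⁆ i v

sumOver-updateAt-suc : {S : Subset m} (x : Vec ℕ m) {i : Fin m} → i ∈ₛ S →
  sumOver S (updateAt x i suc) ≡ suc (sumOver S x)
sumOver-updateAt-suc (x ∷ v) here = refl
sumOver-updateAt-suc {S = true ∷ _}  (x ∷ v) (there i∈S) = trans (cong (x +_) (sumOver-updateAt-suc v i∈S)) (+-suc x _)
sumOver-updateAt-suc {S = false ∷ _} (x ∷ v) (there i∈S) = sumOver-updateAt-suc v i∈S

sumOver-≤ : (S : Subset m) (x : Vec ℕ m) {c : ℕ} → (∀ j → lookup x j ≤ c) → sumOver S x ≤ ∣ S ∣ * c
sumOver-≤ []          []      x≤c = z≤n
sumOver-≤ (true ∷ S)  (x ∷ v) x≤c = +-mono-≤ (x≤c zero) (sumOver-≤ S v (x≤c ∘ suc))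
sumOver-≤ (false ∷ S) (x ∷ v) x≤c = sumOver-≤ S v (x≤c ∘ suc)

-- The nonnegative slacks c - x_j over `S` add up to at most 0, so each of them is 0.
saturated : {S : Subset m} (x : Vec ℕ m) {c : ℕ} → (∀ j → lookup x j ≤ c) → ∣ S ∣ * c ≤ sumOver S x →
  ∀ {i} → i ∈ₛ S → lookup x i ≡ c
saturated {S = true ∷ S} (x ∷ v) {c} x≤c full here = ≤-antisym (x≤c zero)
  (+-cancelʳ-≤ (∣ S ∣ * c) c x (≤-trans full (+-monoʳ-≤ x (sumOver-≤ S v (x≤c ∘ suc)))))
saturated {S = true ∷ S} (x ∷ v) {c} x≤c full (there i∈S) = saturated v (x≤c ∘ suc)
  (+-cancelˡ-≤ c _ _ (≤-trans full (+-monoˡ-≤ (sumOver S v) (x≤c zero)))) i∈S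
saturated {S = false ∷ S} (x ∷ v) x≤c full (there i∈S) = saturated v (x≤c ∘ suc) full i∈S

*-≤-sum-take : ∀ (ν : Vec ℕ m) {c} s → s ≤ m → (∀ i → toℕ i < s → c ≤ lookup ν i) → s * c ≤ sum (take s (toList ν))
*-≤-sum-take ν       zero    _         _   = z≤n
*-≤-sum-take (x ∷ ν) (suc s) (s≤s s≤m) c≤ = +-mono-≤ (c≤ zero z<s) (*-≤-sum-take ν s s≤m (λ i i<s → c≤ (suc i) (s≤s i<s)))

dimAtLeast-offHyp : {P Q : Vec ℕ m → Set} (S : Subset m) {a : ℕ} → (∀ {x} → P x → sumOver S x ≡ a) →
  (∀ {x} → P x → Q x) → (y : Vec ℕ m) → Q y → sumOver S y ≢ a → DimAtLeast P d → DimAtLeast Q (suc d)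
dimAtLeast-offHyp {P = P} S {a} onS P⊆Q y Qy off = dimAtLeast-insert {P = P} (indicator S) (pos a)
  (λ {x} Px → trans (dot-indicator S x) (cong pos (onS Px))) P⊆Q y Qy
  (λ eq → off (ℤₚ.+-injective (trans (sym (dot-indicator S y)) eq)))

suc-≢ : ∀ {k l : ℕ} → k ≡ suc l → k ≢ l
suc-≢ refl ()

-- Otherwise raising a coordinate in `S` would give a point off the hyperplane and thus dimension
-- `suc m`.
¬dimAtLeast-hyp : {P : Vec ℕ m → Set} (S : Subset m) {a : ℕ} → Nonempty S → (∀ {x} → P x → sumOver S x ≡ a) →
  ¬ DimAtLeast P m
¬dimAtLeast-hyp {m} {P} S (s , s∈S) onS dimP@(v , Pv , _) =
  ¬dimAtLeast-suc {P = const Unit.⊤}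
    (dimAtLeast-offHyp {P = P} S onS _ (updateAt (v zero) s suc) _
      (λ eq → suc-≢ (sumOver-updateAt-suc (v zero) s∈S) (trans eq (sym (onS (Pv zero))))) dimP)

-- The degree and the coordinates i and j are three independent functionals.
¬dimAtLeast-twoFixed : {P : Vec ℕ (suc (suc n)) → Set} {i j k : Fin (suc (suc n))} {a b c : ℕ} →
  i ≢ j → k ≢ i → k ≢ j →
  (∀ {x} → P x → ∣ x ∣ᵥ ≡ a × lookup x i ≡ b × lookup x j ≡ c) → ¬ DimAtLeast P n
¬dimAtLeast-twoFixed {P = P} {i} {j} {k} {a} {b} {c} i≢j k≢i k≢j fixed dimP@(v , Pv , _) =
  ¬dimAtLeast-suc {P = const Unit.⊤}
    -- To be read from the inside out: raising coordinate `k` changes the degree but keeps `i` and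
    -- `j`, raising `i` keeps `j`, and raising `j` comes last. The dimension grows from `n` to `n` +
    -- 3 in a space of dimension `n` + 2.
    (dimAtLeast-offHyp {P = λ x → lookup x j ≡ c} ⁅ j ⁆ (λ {x} eq → trans (sumOver-⁅⁆ j x) eq) _
      (updateAt x₀ j suc) _ (shifted (⁅ j ⁆) (x∈⁅x⁆ j) (trans (sumOver-⁅⁆ j x₀) xⱼ≡c))
    (dimAtLeast-offHyp {P = λ x → lookup x i ≡ b × lookup x j ≡ c} ⁅ i ⁆ (λ {x} (eq , _) → trans (sumOver-⁅⁆ i x) eq) proj₂
      (updateAt x₀ i suc) (trans (lookup∘updateAt′ j i (i≢j ∘ sym) x₀) xⱼ≡c)
      (shifted (⁅ i ⁆) (x∈⁅x⁆ i) (trans (sumOver-⁅⁆ i x₀) xᵢ≡b))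
    (dimAtLeast-offHyp {P = P} ⊤ (λ {x} Px → trans (sumOver-⊤ x) (proj₁ (fixed Px))) (proj₂ ∘ fixed)
      (updateAt x₀ k suc)
      (trans (lookup∘updateAt′ i k (k≢i ∘ sym) x₀) xᵢ≡b , trans (lookup∘updateAt′ j k (k≢j ∘ sym) x₀) xⱼ≡c)
      (shifted ⊤ ∈⊤ (trans (sumOver-⊤ x₀) (proj₁ (fixed (Pv zero))))) dimP)))
  where
  x₀ = v zero
  xᵢ≡b = proj₁ (proj₂ (fixed (Pv zero)))
  xⱼ≡c = proj₂ (proj₂ (fixed (Pv zero)))
  shifted : (S : Subset _) {l : Fin _} {e : ℕ} → l ∈ₛ S → sumOver S x₀ ≡ e → sumOver S (updateAt x₀ l suc) ≢ e
  shifted S l∈S refl = suc-≢ (sumOver-updateAt-suc x₀ l∈S)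

-- The dimension of Newt(s_μ)

∑-const : (a : ℤ) → ∑ {n} (const a) ≡ pos n *ᶻ a
∑-const {zero}  a = sym (ℤₚ.*-zeroˡ a)
∑-const {suc n} a = trans (cong (a +ᶻ_) (∑-const {n} a)) (sym (ℤₚ.suc-* (pos n) a))

dot-insertAt : (u : Fin (suc n) → ℤ) (ys : Vec ℕ n) (j : Fin (suc n)) (y : ℕ) →
  dot u (insertAt ys j y) ≡ u j *ᶻ pos y +ᶻ dot (u ∘ punchIn j) ys
dot-insertAt u ys       zero    y = refl
dot-insertAt u (x ∷ ys) (suc j) y = trans (cong (u zero *ᶻ pos x +ᶻ_) (dot-insertAt (u ∘ suc) ys j y))
  (lemma (u zero *ᶻ pos x) (u (suc j) *ᶻ pos y) _)
  where
  lemma : ∀ a b c → a +ᶻ (b +ᶻ c) ≡ b +ᶻ (a +ᶻ c)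
  lemma = ℤ-Solver.solve-∀

toList-insertAt-↭ : ∀ (ys : Vec ℕ n) j y → toList (insertAt ys j y) ↭ y ∷ toList ys
toList-insertAt-↭ ys       zero    y = ↭-refl
toList-insertAt-↭ (x ∷ ys) (suc j) y = ↭-trans (prep x (toList-insertAt-↭ ys j y)) (swap x y ↭-refl)

-- Swapping the largest and the smallest part between two positions at which u differs moves
-- the permuted point off a hyperplane orthogonal to u.
suppSchur-dim-suc : ∀ {x y} (ys : Vec ℕ n) → IsPartition (x ∷ (ys ∷ʳ y)) → x ≢ y → d < suc n →
  DimAtLeast (SuppSchur (x ∷ (ys ∷ʳ y))) d → DimAtLeast (SuppSchur (x ∷ (ys ∷ʳ y))) (suc d)
suppSchur-dim-suc {n} {d} {x} {y} ys part x≢y d<1+n (v , Pv , indep) = extended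
  where
  μ = x ∷ (ys ∷ʳ y)
  -- The unknowns u_j number `n` + 2, the equations `d` + 1: orthogonality to the differences, and a
  -- vanishing sum of all u_j, which excludes nonzero constant solutions.
  constraints : Fin (suc (suc n)) → Fin (suc d) → ℤ
  constraints j zero    = 1ℤ
  constraints j (suc t) = difference (v (suc t)) (v zero) j
  dependence = linearlyDependent (s≤s d<1+n) constraints
  u = proj₁ dependence
  relation = proj₁ (proj₂ dependence)
  constant : ∀ t → dot u (v (suc t)) ≡ dot u (v zero)
  constant t = ℤₚ.i-j≡0⇒i≡j _ _ (trans (sym (∑-difference u (v (suc t)) (v zero))) (relation (suc t)))
  varies : ∃ λ j → u zero ≢ u (suc j)
  varies with Finₚ.any? (λ j → ¬? (u zero ≟ᶻ u (suc j)))
  ... | yes found = found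
  ... | no  none  = contradiction (trans (u≡u₀ (proj₁ nonzero)) u₀≡0) (proj₂ nonzero)
    where
    nonzero = proj₂ (proj₂ dependence)
    u≡u₀ : ∀ j → u j ≡ u zero
    u≡u₀ zero    = refl
    u≡u₀ (suc j) = sym (decidable-stable (u zero ≟ᶻ u (suc j)) (λ ≢ → none (j , ≢)))
    m*u₀≡0 : pos (suc (suc n)) *ᶻ u zero ≡ 0ℤ
    m*u₀≡0 = trans (sym (∑-const {suc (suc n)} (u zero)))
      (trans (∑-cong (λ j → trans (sym (u≡u₀ j)) (sym (ℤₚ.*-identityʳ (u j))))) (relation zero))
    u₀≡0 : u zero ≡ 0ℤ
    u₀≡0 with ℤₚ.i*j≡0⇒i≡0∨j≡0 (pos (suc (suc n))) m*u₀≡0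
    ... | inj₂ ≡0 = ≡0
  j = proj₁ varies
  α = x ∷ insertAt ys j y
  β = y ∷ insertAt ys j x
  μ↭ : toList μ ↭ x ∷ y ∷ toList ys
  μ↭ = prep x (↭-trans (↭-reflexive (toList-∷ʳ y ys)) (↭-sym (∷↭∷ʳ y (toList ys))))
  α-supp : SuppSchur μ α
  α-supp = suppSchur-permutation μ part α (↭-trans (prep x (toList-insertAt-↭ ys j y)) (↭-sym μ↭))
  β-supp : SuppSchur μ β
  β-supp = suppSchur-permutation μ part β (↭-trans (prep y (toList-insertAt-↭ ys j x)) (↭-trans (swap y x ↭-refl) (↭-sym μ↭)))
  α≢β : dot u α ≢ dot u β
  α≢β eq = nonzero (ℤₚ.i*j≡0⇒i≡0∨j≡0 (u zero -ᶻ u (suc j)) product≡0)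
    where
    r = dot (u ∘ suc ∘ punchIn j) ys
    product≡0 : (u zero -ᶻ u (suc j)) *ᶻ (pos x -ᶻ pos y) ≡ 0ℤ
    product≡0 = trans (lemma (u zero) (u (suc j)) (pos x) (pos y) r) (ℤₚ.i≡j⇒i-j≡0
      (trans (cong (u zero *ᶻ pos x +ᶻ_) (sym (dot-insertAt (u ∘ suc) ys j y)))
        (trans eq (cong (u zero *ᶻ pos y +ᶻ_) (dot-insertAt (u ∘ suc) ys j x)))))
      where
      lemma : ∀ a b x y r → (a -ᶻ b) *ᶻ (x -ᶻ y) ≡ a *ᶻ x +ᶻ (b *ᶻ y +ᶻ r) -ᶻ (a *ᶻ y +ᶻ (b *ᶻ x +ᶻ r))
      lemma = ℤ-Solver.solve-∀
    nonzero : ¬ (u zero -ᶻ u (suc j) ≡ 0ℤ ⊎ pos x -ᶻ pos y ≡ 0ℤ)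
    nonzero (inj₁ ≡0) = proj₂ varies (ℤₚ.i-j≡0⇒i≡j _ _ ≡0)
    nonzero (inj₂ ≡0) = x≢y (ℤₚ.+-injective (ℤₚ.i-j≡0⇒i≡j _ _ ≡0))
  insert : ∀ z → SuppSchur μ z → dot u z ≢ dot u (v zero) → DimAtLeast (SuppSchur μ) (suc d)
  insert z z-supp differs = insertPoint z v , supp , affIndep-insert v indep u z constant differs
    where
    supp : ∀ t → SuppSchur μ (insertPoint z v t)
    supp zero          = Pv zero
    supp (suc zero)    = z-supp
    supp (suc (suc t)) = Pv (suc t)
  extended : DimAtLeast (SuppSchur μ) (suc d)
  -- `u` takes different values at `α` and `β`, so at least one of them is off the hyperplane
  -- through the old points.
  extended with dot u α ≟ᶻ dot u (v zero)
  ... | no differs = insert α α-supp differs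
  ... | yes same   = insert β β-supp (λ eq → α≢β (trans same (sym eq)))

¬dimAtLeast-one : {P : Vec ℕ m → Set} (c : Fin m → ℕ) → (∀ {x} → P x → ∀ j → lookup x j ≡ c j) → ¬ DimAtLeast P 1
¬dimAtLeast-one c fixed (v , Pv , indep) = contradiction (indep (const 1ℤ) relation zero) λ ()
  where
  relation : ∀ j → 1ℤ *ᶻ difference (v (suc zero)) (v zero) j +ᶻ 0ℤ ≡ 0ℤ
  relation j rewrite fixed (Pv zero) j | fixed (Pv (suc zero)) j | ℤₚ.+-inverseʳ (pos (c j)) = refl

lookup-last : ∀ {y} (ys : Vec ℕ n) → lookup (ys ∷ʳ y) (fromℕ n) ≡ y
lookup-last []       = refl
lookup-last (_ ∷ ys) = lookup-last ys

isPartition-last : ∀ {y} (ys : Vec ℕ n) → IsPartition (ys ∷ʳ y) → ∀ i → y ≤ lookup (ys ∷ʳ y) i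
isPartition-last {y = y} ys part i = subst (_≤ lookup (ys ∷ʳ y) i) (lookup-last ys)
  (part i (fromℕ _) (Finₚ.≤fromℕ i))

-- If the extreme parts agree, all parts equal `x`. Then every coordinate is at most `x` while the
-- degree forces equality, so the support is a single point.
suppSchur-nonconstant : ∀ {x y} (ys : Vec ℕ n) → IsPartition (x ∷ (ys ∷ʳ y)) →
  DimAtLeast (SuppSchur (x ∷ (ys ∷ʳ y))) (suc d) → x ≢ y
suppSchur-nonconstant {n} {x = x} ys part dim refl =
  ¬dimAtLeast-one {P = SuppSchur μ} (const x) (λ {α} → constant α) (dimAtLeast-≤ {P = SuppSchur μ} (s≤s z≤n) dim)
  where
  μ = x ∷ (ys ∷ʳ x)
  constant : ∀ α → SuppSchur μ α → ∀ j → lookup α j ≡ x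
  constant α supp j = saturated α (suppSchur-bound (ys ∷ʳ x) α part supp) full ∈⊤
    where
    open ≤-Reasoning
    full : ∣ ⊤ {suc (suc n)} ∣ * x ≤ sumOver ⊤ α
    full = begin
      ∣ ⊤ {suc (suc n)} ∣ * x                             ≡⟨ cong (_* x) (∣⊤∣≡n (suc (suc n))) ⟩
      suc (suc n) * x                                     ≤⟨ *-≤-sum-take μ (suc (suc n)) ≤-refl (λ i _ → isPartition-last (x ∷ ys) part i) ⟩
      sum (take (suc (suc n)) (toList μ))                 ≤⟨ m≤m+n _ _ ⟩
      sum (take (suc (suc n)) (toList μ)) + sum (drop (suc (suc n)) (toList μ)) ≡⟨ sum-take-drop (suc (suc n)) μ ⟩
      ∣ μ ∣ᵥ                                              ≡⟨ suppSchur-sum μ α supp ⟨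
      ∣ α ∣ᵥ                                              ≡⟨ sumOver-⊤ α ⟨
      sumOver ⊤ α                                         ∎

-- If `d` < `n`, the support, of dimension `suc d`, could still be enlarged by `suppSchur-dim-suc`,
-- contradicting the maximality of its dimension.
facet-dim : ∀ {x y} (ys : Vec ℕ n) → IsPartition (x ∷ (ys ∷ʳ y)) → ∀ {H} →
  DefinesFacet H (SuppSchur (x ∷ (ys ∷ʳ y))) → DimAtLeast (SuppSchur (x ∷ (ys ∷ʳ y)) ∩H H) n
facet-dim {n} {x = x} {y} ys part {H} (_ , d , (dimP , ¬dimP) , dimF , _) with n ≤? d
... | yes n≤d = dimAtLeast-≤ {P = SuppSchur (x ∷ (ys ∷ʳ y)) ∩H H} n≤d dimF
... | no  n≰d = contradiction
  (suppSchur-dim-suc ys part (suppSchur-nonconstant ys part dimP) (s≤s (≰⇒> n≰d)) dimP) ¬dimP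

-- Otherwise the face would be as large as the whole. This excludes isolation from the wrong side.
facet-proper : ∀ {H} {P : Vec ℕ m → Set} → DefinesFacet H P → ¬ (∀ x → P x → OnHyp H x)
facet-proper {H = H} {P} (_ , _ , (dimP , _) , _ , ¬dimF) onH =
  ¬dimF (dimAtLeast-⊆ {P = P} {Q = P ∩H H} (λ {x} Px → Px , onH x Px) dimP)

-- An additional point of another degree

least : {P : Fin m → Set} → (∀ i → Dec (P i)) → ∃ P → ∃ λ i → P i × (∀ j → j Fin.< i → ¬ P j)
least {suc m} P? found with P? zero
least {suc m} P? found          | yes P₀ = zero , P₀ , λ _ ()
least {suc m} P? (zero , P₀)    | no ¬P₀ = contradiction P₀ ¬P₀
least {suc m} P? (suc i , Pi)   | no ¬P₀ =
  let k , Pk , below = least (P? ∘ suc) (i , Pi)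
  in suc k , Pk , λ { zero _ → ¬P₀ ; (suc j) (s≤s j<k) → below j j<k }

greatest : {P : Fin m → Set} → (∀ i → Dec (P i)) → ∃ P → ∃ λ i → P i × (∀ j → i Fin.< j → ¬ P j)
greatest {suc m} P? found with Finₚ.any? (P? ∘ suc)
... | yes later = let k , Pk , above = greatest (P? ∘ suc) later
                  in suc k , Pk , λ { (suc j) (s≤s k<j) → above j k<j }
greatest {suc m} P? (suc i , Pi) | no none = contradiction (i , Pi) none
greatest {suc m} P? (zero , P₀)  | no none = zero , P₀ , λ { (suc j) _ Pj → none (j , Pj) }

OtherDegree : ℕ → Vec ℕ m → Vec ℕ m → Subset m → ℕ → Set
OtherDegree {m} h lam mu S a = Σ (Vec ℕ m) λ y → SuppG h lam y × ∣ y ∣ᵥ ≢ ∣ mu ∣ᵥ × sumOver S y ≡ a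

arranged : ∀ {h} {lam : Vec ℕ m} → 1 ≤ h → IsPartition lam → (I : Subset m) (ν : Vec ℕ m) → Candidate h lam ν →
  Σ (Vec ℕ m) λ y → SuppG h lam y × ∣ y ∣ᵥ ≡ ∣ ν ∣ᵥ ×
    sumOver I y ≡ sum (take ∣ I ∣ (toList ν)) × sumOver (∁ I) y ≡ sum (drop ∣ I ∣ (toList ν))
arranged {h = h} {lam} 1≤h partλ I ν cand =
  let y , perm , sums = arrangeOnto I ν
      supp = suppSchur-permutation ν (partition cand) y perm
  in y , suppSchur⇒suppG h lam ν 1≤h partλ cand y supp , suppSchur-sum ν y supp , sums

∣I∣<m : (I : Subset m) → Nonempty (∁ I) → ∣ I ∣ < m
∣I∣<m I (k , k∈∁I) = ≤∧≢⇒< (∣p∣≤n I) λ eq →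
  x∈∁p⇒x∉p k∈∁I (subst (k ∈ₛ_) (sym (∣p∣≡n⇒p≡⊤ eq)) ∈⊤)

otherDegree-top : ∀ {h} {lam mu : Vec ℕ (suc (suc n))} → 1 ≤ h → IsPartition lam → lookup lam (fromℕ (suc n)) ≡ 0 →
  Candidate h lam mu → lookup mu zero ≢ lookup mu (fromℕ (suc n)) → (I : Subset (suc (suc n))) → Nonempty (∁ I) →
  (∀ x → SuppG h lam x → sumOver I x ≤ sum (take ∣ I ∣ (toList mu))) →
  OtherDegree h lam mu I (sum (take ∣ I ∣ (toList mu)))
otherDegree-top {n} {h} {lam} {mu} 1≤h partλ λℓ≡0 cand μ₀≢μℓ I ∁I≢∅ bound with lookup mu (fromℕ (suc n)) in μℓ
... | suc _ =
  -- Since λ_m = 0, the box lies outside λ; since |I| < m, the first |I| parts keep their sum.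
  let ν = updateAt mu ℓ pred
      y , supp , deg , inI , _ = arranged 1≤h partλ I ν (candidate-pred cand ℓ
        (λ j ℓ<j → contradiction (Finₚ.≤fromℕ j) (<⇒≱ ℓ<j))
        (subst₂ _<_ (sym λℓ≡0) (sym μℓ) z<s))
  in y , supp
   , (λ eq → suc-≢ (sym (sum-updateAt-pred mu ℓ (subst (0 <_) (sym μℓ) z<s))) (trans (sym eq) deg))
   , trans inI (cong sum (take-updateAt mu ℓ pred ∣ I ∣
       (subst (∣ I ∣ ≤_) (sym (Finₚ.toℕ-fromℕ (suc n))) (s≤s⁻¹ (∣I∣<m I ∁I≢∅)))))
  where ℓ = fromℕ (suc n)
... | zero with least (λ i → lookup mu i ≟ 0) (fromℕ (suc n) , μℓ)
... | zero  , μ₀≡0 , _ = contradiction μ₀≡0 μ₀≢μℓ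
-- A row other than the first has room for at least `h` ≥ 1 boxes beyond λ.
... | r@(suc r′) , μr≡0 , below =
  let ν = updateAt mu r suc
      y , supp , deg , inI , _ = arranged 1≤h partλ I ν (candidate-suc cand r
        (λ i i<r → subst (_< lookup mu i) (sym μr≡0) (n≢0⇒n>0 (below i i<r)))
        (subst (_< lookup lam r + h * toℕ r) (sym μr≡0) (m≤n⇒m≤o+n (lookup lam r) (*-mono-≤ 1≤h (s≤s z≤n)))))
  in y , supp , suc-≢ (trans deg (sum-updateAt-suc mu r))
   -- The added box may lie in one of the first |I| rows; this can only increase the sum, and
   -- isolation forbids an increase.
   , ≤-antisym (bound y supp) (≤-trans (take-updateAt-suc mu r ∣ I ∣) (≤-reflexive (sym inI)))

lookup-injective : {x y : Vec ℕ m} → (∀ i → lookup x i ≡ lookup y i) → x ≡ y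
lookup-injective {x = x} {y} eq = trans (sym (tabulate∘lookup x)) (trans (tabulate-cong eq) (tabulate∘lookup y))

otherDegree-bottom : ∀ {h} {lam mu : Vec ℕ (suc (suc n))} → 1 ≤ h → IsPartition lam → Candidate h lam mu →
  (I : Subset (suc (suc n))) → Nonempty I → Nonempty (∁ I) →
  DimAtLeast (SuppSchur mu ∩H hyp I (sum (take ∣ I ∣ (toList mu)))) n →
  (∀ j → hyp (∁ I) (∣ mu ∣ᵥ ∸ sum (take ∣ I ∣ (toList mu))) ≢ 𝒥 lam j) →
  (∀ x → SuppG h lam x → sum (drop ∣ I ∣ (toList mu)) ≤ sumOver (∁ I) x) →
  OtherDegree h lam mu (∁ I) (sum (drop ∣ I ∣ (toList mu)))
otherDegree-bottom {n} {h} {lam} {mu} 1≤h partλ cand I (i₀ , i₀∈I) (k , k∈∁I) dimF ≢𝒥 bound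
  with Finₚ.any? (λ i → lookup lam i <? lookup mu i)
... | yes larger =
  -- The last row exceeding λ ends in a corner, because μ_j ≤ λ_j ≤ λ_r < μ_r for all later rows.
  let r , λr<μr , above = greatest (λ i → lookup lam i <? lookup mu i) larger
      ν = updateAt mu r pred
      y , supp , deg , _ , offI = arranged 1≤h partλ I ν (candidate-pred cand r
        (λ j r<j → ≤-<-trans (≮⇒≥ (above j r<j)) (≤-<-trans (partλ r j (<⇒≤ r<j)) λr<μr)) λr<μr)
  in y , supp
   , (λ eq → suc-≢ (sym (sum-updateAt-pred mu r (≤-<-trans z≤n λr<μr))) (trans (sym eq) deg))
   , ≤-antisym (≤-trans (≤-reflexive offI) (drop-updateAt-pred mu r ∣ I ∣)) (bound y supp)
... | no  none with lookup-injective {x = mu} {lam}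
                      (λ i → ≤-antisym (≮⇒≥ (λ λi<μi → none (i , λi<μi))) (lower cand i))
... | refl with Finₚ.any? (λ i → (toℕ i <? ∣ I ∣) ×-dec (lookup lam i <? lookup lam zero))
... | yes smaller with least (λ i → (toℕ i <? ∣ I ∣) ×-dec (lookup lam i <? lookup lam zero)) smaller
... | zero , (_ , λ₀<λ₀) , _ = contradiction λ₀<λ₀ (<-irrefl refl)
-- By minimality all earlier rows have length at least λ_1, so a box fits into row `r`; as it is
-- among the first |I| rows, the sum of the remaining parts does not change.
... | r@(suc _) , (r<s , λr<λ₀) , below =
  let ν = updateAt lam r suc
      y , supp , deg , _ , offI = arranged 1≤h partλ I ν (candidate-suc cand r
        (λ i i<r → <-≤-trans λr<λ₀ (≮⇒≥ (λ λi<λ₀ → below i i<r (<-trans i<r r<s , λi<λ₀))))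
        (m<m+n (lookup lam r) (*-mono-≤ 1≤h (s≤s z≤n))))
  in y , supp , suc-≢ (trans deg (sum-updateAt-suc lam r))
   , trans offI (cong sum (drop-updateAt lam r suc ∣ I ∣ r<s))
otherDegree-bottom {n} {h} {lam@(λ₀ ∷ λ′)} 1≤h partλ cand I (i₀ , i₀∈I) (k , k∈∁I) dimF ≢𝒥 bound | no _ | refl | no flat
  -- Now the first |I| parts all equal `λ₀`, hence so do the coordinates in `I` of every point of
  -- the facet. Two such coordinates besides the degree would make its dimension smaller than `n`.
  with Finₚ.any? (λ j → (j ∈? I) ×-dec ¬? (j Finₚ.≟ i₀))
... | yes (j , j∈I , j≢i₀) = contradiction dimF
  (¬dimAtLeast-twoFixed {P = SuppSchur lam ∩H hyp I (sum (take ∣ I ∣ (toList lam)))} {i = j} {i₀} {k}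
    j≢i₀ (k≢ j∈I) (k≢ i₀∈I)
    (λ {x} (supp , onH) → suppSchur-sum lam x supp , fixed x supp onH j∈I , fixed x supp onH i₀∈I))
  where
  k≢ : ∀ {i} → i ∈ₛ I → k ≢ i
  k≢ i∈I refl = x∈∁p⇒x∉p k∈∁I i∈I
  fixed : ∀ x → SuppSchur lam x → sumOver I x ≡ sum (take ∣ I ∣ (toList lam)) → ∀ {i} → i ∈ₛ I → lookup x i ≡ λ₀
  fixed x supp onH = saturated x (suppSchur-bound λ′ x partλ supp)
    (≤-trans (*-≤-sum-take lam ∣ I ∣ (∣p∣≤n I) (λ i i<s → ≮⇒≥ (λ λi<λ₀ → flat (i , i<s , λi<λ₀))))
             (≤-reflexive (sym onH)))
... | no single with ⊆-antisym {i = I} {⁅ i₀ ⁆}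
    (λ {j} j∈I → subst (_∈ₛ ⁅ i₀ ⁆) (sym (decidable-stable (j Finₚ.≟ i₀) (λ j≢i₀ → single (j , j∈I , j≢i₀)))) (x∈⁅x⁆ i₀))
    (λ {j} j∈ → subst (_∈ₛ I) (sym (x∈⁅y⁆⇒x≡y i₀ j∈)) i₀∈I)
-- `I` is a singleton, so L is `λ₀` and the hyperplane is `𝒥 lam i₀`.
... | refl = contradiction
  (cong (λ a → hyp (∁ ⁅ i₀ ⁆) (∣ lam ∣ᵥ ∸ a))
    (trans (cong (λ s → sum (take s (toList lam))) (∣⁅x⁆∣≡1 i₀)) (+-identityʳ λ₀)))
  (≢𝒥 i₀)

-- From facets of Newt(s_μ) to facets of Newt(G)

facetDefining : ∀ {h} {lam mu : Vec ℕ (suc (suc n))} (S : Subset (suc (suc n))) (a : ℕ) → Nonempty S →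
  Isolates (hyp S a) (SuppG h lam) → {F : Vec ℕ (suc (suc n)) → Set} → DimAtLeast F n →
  (∀ {x} → F x → (SuppG h lam ∩H hyp S a) x) → (∀ {x} → F x → ∣ x ∣ᵥ ≡ ∣ mu ∣ᵥ) →
  OtherDegree h lam mu S a → FacetDefining (hyp S a) (SuppG h lam)
facetDefining {h = h} {lam} S a S≢∅ isolates {F} dimF F⊆ degree (y , supp , deg≢ , onH) =
  isolates ,
  -- `F` has dimension `n` inside one degree, so a point of another degree on the hyperplane raises
  -- it to `n` + 1 = m - 1.
  dimAtLeast-offHyp {P = F} {Q = SuppG h lam ∩H hyp S a} ⊤ (λ {x} Fx → trans (sumOver-⊤ x) (degree Fx)) F⊆
    y (supp , onH) (λ eq → deg≢ (trans (sym (sumOver-⊤ y)) eq)) dimF ,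
  ¬dimAtLeast-hyp {P = SuppG h lam ∩H hyp S a} S S≢∅ proj₂

-- The theorem for an arbitrary admissible partition in place of a member of the dominating
-- sequence.
facet-extends : ∀ h → 1 ≤ h → (lam mu : Vec ℕ (suc (suc n))) → IsPartition lam → lookup lam (fromℕ (suc n)) ≡ 0 →
  Candidate h lam mu → (I : Subset (suc (suc n))) → Nonempty I → Nonempty (∁ I) →
  let L = sum (take ∣ I ∣ (toList mu))
      H₁ = hyp I L
      H₀ = hyp (∁ I) (∣ mu ∣ᵥ ∸ L)
  in DefinesFacet H₁ (SuppSchur mu) → (H : Hyp (suc (suc n))) → (H ≡ H₁ ⊎ H ≡ H₀) →
     Isolates H (SuppG h lam) → (∀ j → H ≢ 𝒥 lam j) → FacetDefining H (SuppG h lam)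
facet-extends {n} h 1≤h lam mu@(x ∷ μ′) partλ λℓ≡0 cand I I≢∅ ∁I≢∅ facet with initLast μ′
... | ys , y , refl = cases
  where
  open ≤-Reasoning
  L = sum (take ∣ I ∣ (toList mu))
  R = sum (drop ∣ I ∣ (toList mu))
  F = SuppSchur mu ∩H hyp I L
  F⇒G : ∀ α → SuppSchur mu α → SuppG h lam α
  F⇒G = suppSchur⇒suppG h lam mu 1≤h partλ cand
  dimF : DimAtLeast F n
  dimF = facet-dim ys (partition cand) {hyp I L} facet
  drop≡ : R ≡ ∣ mu ∣ᵥ ∸ L
  drop≡ = trans (sym (m+n∸m≡n L _)) (cong (_∸ L) (sum-take-drop ∣ I ∣ mu))
  complement : ∀ α → SuppSchur mu α → sumOver (∁ I) α ≡ ∣ mu ∣ᵥ ∸ sumOver I α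
  complement α supp = trans (sym (m+n∸m≡n (sumOver I α) _))
    (cong (_∸ sumOver I α) (trans (sumOver-∁ I α) (suppSchur-sum mu α supp)))
  μ₀≢μℓ : lookup mu zero ≢ lookup mu (fromℕ (suc n))
  μ₀≢μℓ eq = suppSchur-nonconstant ys (partition cand) (proj₁ (proj₁ (proj₂ (proj₂ facet)))) (trans eq (lookup-last ys))
  cases : (H : Hyp (suc (suc n))) → (H ≡ hyp I L ⊎ H ≡ hyp (∁ I) (∣ mu ∣ᵥ ∸ L)) →
    Isolates H (SuppG h lam) → (∀ j → H ≢ 𝒥 lam j) → FacetDefining H (SuppG h lam)
  cases H (inj₁ refl) isolates@(inj₁ above) _ = facetDefining {h = h} {lam} {mu} I L I≢∅ isolates {F} dimF
    (λ {α} (supp , onH) → F⇒G α supp , onH) (λ {α} (supp , _) → suppSchur-sum mu α supp)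
    (otherDegree-top 1≤h partλ λℓ≡0 cand μ₀≢μℓ I ∁I≢∅ above)
  -- Isolation from this side, together with the facet inequality, would put all of Newt(s_μ) on the
  -- hyperplane.
  cases H (inj₁ refl) (inj₂ below) _ = contradiction
    (λ α supp → ≤-antisym (proj₁ facet α supp) (below α (F⇒G α supp)))
    (facet-proper {H = hyp I L} facet)
  -- In the degree of μ, an upper bound for the sum off `I` is a lower bound for the sum over `I`,
  -- so the same contradiction arises.
  cases H (inj₂ refl) (inj₁ above) _ = contradiction
    (λ α supp → ≤-antisym (proj₁ facet α supp) (+-cancelʳ-≤ R L _ (begin
      L + R                            ≡⟨ sum-take-drop ∣ I ∣ mu ⟩
      ∣ mu ∣ᵥ                          ≡⟨ suppSchur-sum mu α supp ⟨
      ∣ α ∣ᵥ                           ≡⟨ sumOver-∁ I α ⟨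
      sumOver I α + sumOver (∁ I) α    ≤⟨ +-monoʳ-≤ (sumOver I α) (above α (F⇒G α supp)) ⟩
      sumOver I α + (∣ mu ∣ᵥ ∸ L)      ≡⟨ cong (sumOver I α +_) drop≡ ⟨
      sumOver I α + R                  ∎)))
    (facet-proper {H = hyp I L} facet)
  cases H (inj₂ refl) isolates@(inj₂ below) ≢𝒥 = facetDefining {h = h} {lam} {mu} (∁ I) (∣ mu ∣ᵥ ∸ L) ∁I≢∅ isolates {F} dimF
    (λ {α} (supp , onH) → F⇒G α supp , trans (complement α supp) (cong (∣ mu ∣ᵥ ∸_) onH))
    (λ {α} (supp , _) → suppSchur-sum mu α supp)
    (subst (OtherDegree h lam mu (∁ I)) drop≡
      (otherDegree-bottom 1≤h partλ cand I I≢∅ ∁I≢∅ dimF ≢𝒥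
        (λ α supp → ≤-trans (≤-reflexive drop≡) (below α supp))))

theorem4p15 : (m : ℕ) → 2 ≤ m → (h : ℕ) → 1 ≤ h →
  (lam : Vec ℕ m) → IsPartition lam →
  ((i : Fin m) → toℕ i ≡ m ∸ 1 → lookup lam i ≡ 0) →
  (N : ℕ) → DegG h lam (∣ lam ∣ᵥ + N) →
  (k : ℕ) → 1 ≤ k → k ≤ m →
  (I : Subset m) → Nonempty I → Nonempty (∁ I) →
  let lamN = domSeq h lam N
      a = tabulate (λ i → lookup lamN i ∸ lookup lam i)
      bk = sum (take k (toList a))
      mu = domSeq h lam bk
      L = sum (take ∣ I ∣ (toList mu))
      H₁ = hyp I L
      H₀ = hyp (∁ I) (∣ mu ∣ᵥ ∸ L)
  in DefinesFacet H₁ (SuppSchur mu) →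
     (H : Hyp m) → (H ≡ H₁ ⊎ H ≡ H₀) →
     Isolates H (SuppG h lam) →
     ((j : Fin m) → ¬ (H ≡ 𝒥 lam j)) →
     FacetDefining H (SuppG h lam)
theorem4p15 (suc (suc n)) _ h 1≤h lam partλ λℓ≡0 N _ k _ _ =
  facet-extends h 1≤h lam (domSeq h lam bₖ) partλ (λℓ≡0 (fromℕ (suc n)) (Finₚ.toℕ-fromℕ (suc n)))
    (domSeq-candidate h lam partλ bₖ)
  where
  bₖ = sum (take k (toList (tabulate (λ i → lookup (domSeq h lam N) i ∸ lookup lam i))))
theorem4p15 (suc zero) (s≤s ())
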